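{- (ZF, without the Axiom of Choice.) The following statements hold: (a) $\omega_2\to(\omega_1)^1_{\omega_1}$; (b) $\omega_2\to(\omega_1,\omega+1)$; (c) $Regressive(\omega_2,\omega_1)$; (d) ${[\omega_2]}^{<\omega}\to\Delta(\omega_1)$.
   Context: The base theory is ZF. Cardinals are initial ordinals. $\omega_2\to(\omega_1)^1_{\omega_1}$ means: for every $f:\omega_2\to\omega_1$ there is a set $H\subset\omega_2$ of cardinality $\omega_1$ on which $f$ is constant. $\omega_2\to(\omega_1,\omega+1)$ means: for every $f:[\omega_2]^2\to 2$ there is either a set $H\subset\omega_2$ of order type $\omega_1$ with $f$ constantly $0$ on $[H]^2$, or a set $H\subset\omega_2$ of order type $\omega+1$ with $f$ constantly $1$ on $[H]^2$. For cardinals $\mu,\lambda\in On$, $Regressive(\mu,\lambda)$ means: for each regressive function $f:\mu\to\mu$ (i.e. $f(\alpha)<\alpha$ for all $0<\alpha<\mu$) there is $\alpha<\mu$ such that $|f^{ -1}\{\alpha\}|\ge\lambda$. For infinite cardinals $\mu,\lambda$, ${[\mu]}^{<\omega}\to\Delta(\lambda)$ means: every family $\mathcal A$ of finite sets of ordinals with $|\mathcal A|=\mu$ contains a $\Delta$-system $\mathcal B\subset\mathcal A$ with $|\mathcal B|=\lambda$ (a $\Delta$-system is a family for which there is a set $D$, the kernel, such that $A\cap B=D$ for all distinct members $A,B$). -}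

module Defs where

open import Level using (Level; suc)
open import Data.Nat.Base as ℕ using (ℕ)
open import Data.Fin.Base using (Fin)
open import Data.Vec.Base using (Vec; _∷_; lookup)
open import Data.Product using (∃-syntax; ∃!; _×_; proj₁)
open import Data.Sum.Base using (_⊎_)
open import Function.Bundles using (_⇔_)
open import Relation.Nullary.Negation.Core using (¬_)
open import Relation.Binary.PropositionalEquality.Core using (_≡_; _≢_)

-- First-order formulas over the signature {∈}, with equality, in de Bruijn
-- style: `Formula n` has its free variables among 0, …, n-1, and a quantifier
-- binds variable 0.  They are needed only for the two axiom schemes of ZF.

data Formula (n : ℕ) : Set where
  _∈̇_ _≐_         : Fin n → Fin n → Formula n
  ¬̇_              : Formula n → Formula n
  _∧̇_ _∨̇_ _⇒̇_ : Formula n → Formula n → Formula n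
  ∀̇_ ∃̇_          : Formula (ℕ.suc n) → Formula n

module Satisfaction {ℓ : Level} (V : Set ℓ) (_∈_ : V → V → Set ℓ) where

  ⟦_⟧ : ∀ {n} → Formula n → Vec V n → Set ℓ
  ⟦ i ∈̇ j ⟧ ρ = lookup ρ i ∈ lookup ρ j
  ⟦ i ≐ j ⟧ ρ = lookup ρ i ≡ lookup ρ j
  ⟦ ¬̇ φ ⟧   ρ = ¬ ⟦ φ ⟧ ρ
  ⟦ φ ∧̇ ψ ⟧ ρ = ⟦ φ ⟧ ρ × ⟦ ψ ⟧ ρ
  ⟦ φ ∨̇ ψ ⟧ ρ = ⟦ φ ⟧ ρ ⊎ ⟦ ψ ⟧ ρ
  ⟦ φ ⇒̇ ψ ⟧ ρ = ⟦ φ ⟧ ρ → ⟦ ψ ⟧ ρ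
  ⟦ ∀̇ φ ⟧   ρ = ∀ x → ⟦ φ ⟧ (x ∷ ρ)
  ⟦ ∃̇ φ ⟧   ρ = ∃[ x ] ⟦ φ ⟧ (x ∷ ρ)

-- A model of first-order ZF (no choice).
--
-- Separation and Replacement range over first-order formulas with parameters
-- in V, not over arbitrary Agda predicates.  This matters: Σ-types let Agda
-- extract choice functions V → V, and full second-order Replacement would
-- turn these into sets, i.e. would make the axiom of choice true in V.

record ZFModel (ℓ : Level) : Set (suc ℓ) where
  infix 4 _∈_ _⊆_
  field
    V   : Set ℓ
    _∈_ : V → V → Set ℓ

  open Satisfaction V _∈_ public

  _⊆_ : V → V → Set ℓ
  x ⊆ y = ∀ z → z ∈ x → z ∈ y

  field
    extensionality : ∀ x y → (∀ z → z ∈ x ⇔ z ∈ y) → x ≡ y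
    foundation     : ∀ x → (∃[ y ] y ∈ x) →
                     ∃[ y ] y ∈ x × (∀ z → z ∈ x → ¬ z ∈ y)
    emptySet       : ∃[ e ] ∀ z → ¬ z ∈ e
    pairing        : ∀ x y → ∃[ p ] ∀ z → z ∈ p ⇔ (z ≡ x ⊎ z ≡ y)
    union          : ∀ x → ∃[ u ] ∀ z → z ∈ u ⇔ (∃[ y ] y ∈ x × z ∈ y)
    powerSet       : ∀ x → ∃[ p ] ∀ z → z ∈ p ⇔ z ⊆ x
    separation     : ∀ {n} (φ : Formula (ℕ.suc n)) (ρ : Vec V n) a →
                     ∃[ b ] ∀ x → x ∈ b ⇔ (x ∈ a × ⟦ φ ⟧ (x ∷ ρ))
    replacement    : ∀ {n} (φ : Formula (ℕ.suc (ℕ.suc n))) (ρ : Vec V n) a →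
                     (∀ x → x ∈ a → ∀ y y′ →
                       ⟦ φ ⟧ (x ∷ y ∷ ρ) → ⟦ φ ⟧ (x ∷ y′ ∷ ρ) → y ≡ y′) →
                     ∃[ b ] ∀ y → y ∈ b ⇔ (∃[ x ] x ∈ a × ⟦ φ ⟧ (x ∷ y ∷ ρ))

  ∅ : V
  ∅ = proj₁ emptySet

  pair : V → V → V
  pair x y = proj₁ (pairing x y)

  singleton : V → V
  singleton x = pair x x

  ⋃ : V → V
  ⋃ x = proj₁ (union x)

  succ : V → V
  succ x = ⋃ (pair x (singleton x))

  Inductive : V → Set ℓ
  Inductive I = ∅ ∈ I × (∀ x → x ∈ I → succ x ∈ I)

  field
    infinity : ∃[ I ] Inductive I

module SetTheory {ℓ : Level} (M : ZFModel ℓ) where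
  open ZFModel M public

  infix 4 _∋_↦_ _≈_ _≤ₒ_

  -- Unary predicates on V, i.e. classes; they are used as domains and
  -- codomains so that [κ]² need not be introduced as a set.
  Class : Set (suc ℓ)
  Class = V → Set ℓ

  𝟘 𝟙 𝟚 : V
  𝟘 = ∅
  𝟙 = succ 𝟘
  𝟚 = succ 𝟙

  ⟨_,_⟩ : V → V → V
  ⟨ x , y ⟩ = pair (singleton x) (pair x y)

  _∋_↦_ : V → V → V → Set ℓ
  f ∋ x ↦ y = ⟨ x , y ⟩ ∈ f

  IsFunction : Class → Class → V → Set ℓ
  IsFunction D C f =
    (∀ p → p ∈ f → ∃[ x ] ∃[ y ] D x × C y × p ≡ ⟨ x , y ⟩) ×
    (∀ x → D x → ∃! _≡_ λ y → f ∋ x ↦ y)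

  IsBijection : V → V → V → Set ℓ
  IsBijection a b f =
    IsFunction (_∈ a) (_∈ b) f × (∀ y → y ∈ b → ∃! _≡_ λ x → f ∋ x ↦ y)

  _≈_ : V → V → Set ℓ
  a ≈ b = ∃[ f ] IsBijection a b f

  IsTransitive : V → Set ℓ
  IsTransitive x = ∀ y → y ∈ x → y ⊆ x

  record WellOrderedBy∈ (a : V) : Set ℓ where
    field
      irreflexive  : ∀ x → x ∈ a → ¬ x ∈ x
      transitive   : ∀ x y z → x ∈ a → y ∈ a → z ∈ a → x ∈ y → y ∈ z → x ∈ z
      trichotomous : ∀ x y → x ∈ a → y ∈ a → x ∈ y ⊎ x ≡ y ⊎ y ∈ x
      least        : ∀ b → b ⊆ a → (∃[ x ] x ∈ b) →
                     ∃[ m ] m ∈ b × (∀ x → x ∈ b → m ≡ x ⊎ m ∈ x)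

  IsOrdinal : V → Set ℓ
  IsOrdinal α = IsTransitive α × WellOrderedBy∈ α

  _≤ₒ_ : V → V → Set ℓ
  α ≤ₒ β = α ≡ β ⊎ α ∈ β

  IsCardinal : V → Set ℓ
  IsCardinal κ = IsOrdinal κ × (∀ α → α ∈ κ → ¬ α ≈ κ)

  HasCardinality : V → V → Set ℓ
  HasCardinality x κ = IsCardinal κ × x ≈ κ

  -- The order type of a set of ordinals H, ordered by ∈, is the ordinal τ.
  HasOrderType : V → V → Set ℓ
  HasOrderType H τ = IsOrdinal τ × ∃[ g ] IsBijection τ H g ×
    (∀ α β x y → g ∋ α ↦ x → g ∋ β ↦ y → α ∈ β ⇔ x ∈ y)

  IsNatural : V → Set ℓ
  IsNatural n = ∀ I → Inductive I → n ∈ I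

  IsFinite : V → Set ℓ
  IsFinite x = ∃[ n ] IsNatural n × x ≈ n

  Is-ω : V → Set ℓ
  Is-ω w = ∀ n → n ∈ w ⇔ IsNatural n

  IsNextCardinal : V → V → Set ℓ
  IsNextCardinal κ μ =
    IsCardinal μ × κ ∈ μ × (∀ ν → IsCardinal ν → κ ∈ ν → μ ≤ₒ ν)

  [_]² : V → Class
  [ a ]² z = ∃[ x ] ∃[ y ] x ∈ a × y ∈ a × x ≢ y × z ≡ pair x y

  -- κ → (μ)¹_ν
  Arrow¹ : (κ μ ν : V) → Set ℓ
  Arrow¹ κ μ ν = ∀ f → IsFunction (_∈ κ) (_∈ ν) f →
    ∃[ H ] H ⊆ κ × HasCardinality H μ ×
      ∃[ c ] c ∈ ν × (∀ x → x ∈ H → f ∋ x ↦ c)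

  -- κ → (σ , τ), with exponent 2
  Arrow² : (κ σ τ : V) → Set ℓ
  Arrow² κ σ τ = ∀ f → IsFunction [ κ ]² (_∈ 𝟚) f →
    (∃[ H ] H ⊆ κ × HasOrderType H σ × (∀ p → [ H ]² p → f ∋ p ↦ 𝟘)) ⊎
    (∃[ H ] H ⊆ κ × HasOrderType H τ × (∀ p → [ H ]² p → f ∋ p ↦ 𝟙))

  Regressive : (μ ν : V) → Set ℓ
  Regressive μ ν = ∀ f → IsFunction (_∈ μ) (_∈ μ) f →
    (∀ α β → α ∈ μ → 𝟘 ∈ α → f ∋ α ↦ β → β ∈ α) →
    ∃[ α ] α ∈ μ ×
      (∃[ X ] (∀ ξ → ξ ∈ X ⇔ f ∋ ξ ↦ α) ×
        (∃[ κ ] HasCardinality X κ × ν ≤ₒ κ))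

  IsΔSystem : V → Set ℓ
  IsΔSystem 𝓑 = ∃[ D ] ∀ A B → A ∈ 𝓑 → B ∈ 𝓑 → A ≢ B →
    ∀ z → z ∈ D ⇔ (z ∈ A × z ∈ B)

  -- [μ]^{<ω} → Δ(ν)
  ArrowΔ : (μ ν : V) → Set ℓ
  ArrowΔ μ ν = ∀ 𝓐 →
    (∀ A → A ∈ 𝓐 → IsFinite A × (∀ α → α ∈ A → IsOrdinal α)) →
    HasCardinality 𝓐 μ →
    ∃[ 𝓑 ] 𝓑 ⊆ 𝓐 × IsΔSystem 𝓑 × HasCardinality 𝓑 ν

{-# OPTIONS --safe #-}
-- Suppose that one of the four statements fails. Then ω₂ (or a family of size
-- ω₂) is covered by the nodes of a tree of height at most ω in which the
-- children of each node are indexed, uniformly, by countable ordinals (for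
-- (d), by pairs of them). Indices need no choice, because every set of
-- ordinals has a canonical enumeration by its order type, and a set of
-- ordinals containing no subset of type ω₁ is enumerated by countable
-- ordinals. As ω₁ × ω₁ embeds into ω₁ in ZF, such a tree has at most ω₁ nodes,
-- a contradiction.
--
-- The trees are: the pairs of a colour and a position in its fiber (a); for a
-- regressive f, the ordinals below ω₂ with parent function f (c); for a graph
-- without a clique of type ω + 1, the cliques D, extended by the elements of a
-- greedy independent subset of the common upper neighbours of D, a procedure
-- that reaches every α < ω₂ after finitely many steps (b); and finite sets D,
-- extended by the elements of the members of a greedy Δ-system with kernel D
-- (d).

module Submission where

open import Defs
open import Axiom.ExcludedMiddle using (ExcludedMiddle)
open import Data.Empty using (⊥; ⊥-elim)
open import Data.Fin.Base using (Fin; zero; suc; _↑ˡ_; _↑ʳ_; splitAt)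
open import Data.Nat.Base as ℕ using (ℕ)
open import Data.Product using (∃-syntax; ∃!; _×_; _,_; proj₁; proj₂)
open import Data.Sum.Base using (_⊎_; inj₁; inj₂; [_,_]′; swap)
open import Data.Vec.Base using (Vec; []; _∷_; _++_; lookup)
open import Data.Vec.Properties using (lookup-++ˡ; lookup-++ʳ; lookup-splitAt)
open import Function.Base using (_∘_; id; case_of_)
open import Function.Bundles using (_⇔_; mk⇔; module Equivalence)
open import Level using (Level)
open import Relation.Binary.PropositionalEquality using (_≡_; _≢_; refl; sym; trans; cong₂; subst; subst₂)
open import Relation.Nullary.Decidable using (Dec; yes; no; decidable-stable)
open import Relation.Nullary.Negation using (¬_)

open Equivalence using (to; from)

-- In ZF, ω₁ may be a countable union of countable sets, and then ω₁ → (ω₁)¹_ω fails; this is why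
-- homogeneous sets of type ω₁ are sought inside ω₂. Each set of children has countable order type,
-- but picking for all of them at once an enumeration in type ω would need choice. The canonical
-- indices avoid this at a price: they range over all of ω₁, so only the bound ω₁ on the number of
-- nodes survives. A second obstacle is that Separation and Replacement accept formulas only. Every
-- construction therefore carries a first-order definition, and objects that one would define by
-- recursion are described outright: ranks by bisimulations, greedy sets by their initial runs, and
-- the codes of tree nodes by the least closed relation. Each of these is uniquely determined, so
-- nothing is chosen.

lift : ∀ {m n} → (Fin m → Fin n) → Fin (ℕ.suc m) → Fin (ℕ.suc n)
lift f zero    = zero
lift f (suc i) = suc (f i)

rename : ∀ {m n} → (Fin m → Fin n) → Formula m → Formula n
rename f (i ∈̇ j) = f i ∈̇ f j
rename f (i ≐ j) = f i ≐ f j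
rename f (¬̇ φ)   = ¬̇ rename f φ
rename f (φ ∧̇ ψ) = rename f φ ∧̇ rename f ψ
rename f (φ ∨̇ ψ) = rename f φ ∨̇ rename f ψ
rename f (φ ⇒̇ ψ) = rename f φ ⇒̇ rename f ψ
rename f (∀̇ φ)   = ∀̇ rename (lift f) φ
rename f (∃̇ φ)   = ∃̇ rename (lift f) φ

-- Definable predicates and operations

module Definability {ℓ : Level} (M : ZFModel ℓ) where
  open SetTheory M public

  rename-⟦⟧ : ∀ {m n} (φ : Formula m) (f : Fin m → Fin n) {ρ : Vec V n} {σ : Vec V m} →
              (∀ i → lookup ρ (f i) ≡ lookup σ i) → ⟦ rename f φ ⟧ ρ ⇔ ⟦ φ ⟧ σ
  rename-⟦⟧ (i ∈̇ j) f h = mk⇔ (subst₂ _∈_ (h i) (h j)) (subst₂ _∈_ (sym (h i)) (sym (h j)))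
  rename-⟦⟧ (i ≐ j) f h = mk⇔ (subst₂ _≡_ (h i) (h j)) (subst₂ _≡_ (sym (h i)) (sym (h j)))
  rename-⟦⟧ (¬̇ φ) f h = mk⇔ (_∘ from e) (_∘ to e)
    where e = rename-⟦⟧ φ f h
  rename-⟦⟧ (φ ∧̇ ψ) f h =
    mk⇔ (λ (a , b) → to e a , to e′ b) (λ (a , b) → from e a , from e′ b)
    where e = rename-⟦⟧ φ f h ; e′ = rename-⟦⟧ ψ f h
  rename-⟦⟧ (φ ∨̇ ψ) f h =
    mk⇔ [ inj₁ ∘ to e , inj₂ ∘ to e′ ]′ [ inj₁ ∘ from e , inj₂ ∘ from e′ ]′
    where e = rename-⟦⟧ φ f h ; e′ = rename-⟦⟧ ψ f h
  rename-⟦⟧ (φ ⇒̇ ψ) f h = mk⇔ (λ k → to e′ ∘ k ∘ from e) (λ k → from e′ ∘ k ∘ to e)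
    where e = rename-⟦⟧ φ f h ; e′ = rename-⟦⟧ ψ f h
  rename-⟦⟧ (∀̇ φ) f h = mk⇔ (λ k x → to (e x) (k x)) (λ k x → from (e x) (k x))
    where e = λ x → rename-⟦⟧ φ (lift f) λ { zero → refl {x = x} ; (suc i) → h i }
  rename-⟦⟧ (∃̇ φ) f h = mk⇔ (λ (x , p) → x , to (e x) p) (λ (x , p) → x , from (e x) p)
    where e = λ x → rename-⟦⟧ φ (lift f) λ { zero → refl {x = x} ; (suc i) → h i }

  record Definable {n : ℕ} (P : Vec V n → Set ℓ) : Set ℓ where
    no-eta-equality
    constructor definable
    field
      {size}  : ℕ
      par     : Vec V size
      formula : Formula (n ℕ.+ size)
      sound   : ∀ xs → ⟦ formula ⟧ (xs ++ par) ⇔ P xs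

  open Definable

  splice : ∀ {m k n} → (Fin m → Fin n) → (Fin k → Fin n) → Fin (m ℕ.+ k) → Fin n
  splice {m} f g i = [ f , g ]′ (splitAt m i)

  lookup-splice : ∀ {m k n} (f : Fin m → Fin n) (g : Fin k → Fin n)
                  (ρ : Vec V n) (xs : Vec V m) (ys : Vec V k) →
                  (∀ i → lookup ρ (f i) ≡ lookup xs i) → (∀ j → lookup ρ (g j) ≡ lookup ys j) →
                  ∀ i → lookup ρ (splice f g i) ≡ lookup (xs ++ ys) i
  lookup-splice {m} f g ρ xs ys hf hg i with splitAt m i | lookup-splitAt m xs ys i
  ... | inj₁ j | e = trans (hf j) (sym e)
  ... | inj₂ j | e = trans (hg j) (sym e)

  -- Two definitions share their n variables but not their parameters. The parameter vectors are
  -- concatenated behind the variables, and each formula is renamed so that it reads its own block.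
  module Merge {n : ℕ} {P Q : Vec V n → Set ℓ} (A : Definable P) (B : Definable Q) where
    params : Vec V (size A ℕ.+ size B)
    params = par A ++ par B

    intoˡ : Fin (n ℕ.+ size A) → Fin (n ℕ.+ (size A ℕ.+ size B))
    intoˡ = splice (_↑ˡ _) (λ j → n ↑ʳ (j ↑ˡ size B))

    intoʳ : Fin (n ℕ.+ size B) → Fin (n ℕ.+ (size A ℕ.+ size B))
    intoʳ = splice (_↑ˡ _) (λ j → n ↑ʳ (size A ↑ʳ j))

    left : ∀ xs → ⟦ rename intoˡ (formula A) ⟧ (xs ++ params) ⇔ P xs
    left xs = mk⇔ (to (sound A xs) ∘ to e) (from e ∘ from (sound A xs))
      where
        e = rename-⟦⟧ (formula A) intoˡ (lookup-splice (_↑ˡ _) (λ j → n ↑ʳ (j ↑ˡ size B))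
              (xs ++ params) xs (par A) (lookup-++ˡ xs params)
              (λ j → trans (lookup-++ʳ xs params (j ↑ˡ size B)) (lookup-++ˡ (par A) (par B) j)))

    right : ∀ xs → ⟦ rename intoʳ (formula B) ⟧ (xs ++ params) ⇔ Q xs
    right xs = mk⇔ (to (sound B xs) ∘ to e) (from e ∘ from (sound B xs))
      where
        e = rename-⟦⟧ (formula B) intoʳ (lookup-splice (_↑ˡ _) (λ j → n ↑ʳ (size A ↑ʳ j))
              (xs ++ params) xs (par B) (lookup-++ˡ xs params)
              (λ j → trans (lookup-++ʳ xs params (size A ↑ʳ j)) (lookup-++ʳ (par A) (par B) j)))

  abstract
    definable-⇔ : ∀ {n} {P Q : Vec V n → Set ℓ} → Definable P → (∀ xs → P xs ⇔ Q xs) → Definable Q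
    definable-⇔ A e = definable (par A) (formula A)
      λ xs → mk⇔ (to (e xs) ∘ to (sound A xs)) (from (sound A xs) ∘ from (e xs))

    definable-rename : ∀ {m n} {P : Vec V m → Set ℓ} (f : Fin m → Fin n) (g : Vec V n → Vec V m) →
      (∀ ρ i → lookup ρ (f i) ≡ lookup (g ρ) i) → Definable P → Definable (P ∘ g)
    definable-rename {m} {n} f g h A = definable (par A) (rename r (formula A)) λ xs →
      let e = rename-⟦⟧ (formula A) r
                (lookup-splice (λ i → f i ↑ˡ size A) (n ↑ʳ_) (xs ++ par A) (g xs) (par A)
                  (λ i → trans (lookup-++ˡ xs (par A) (f i)) (h xs i)) (lookup-++ʳ xs (par A)))
      in mk⇔ (to (sound A (g xs)) ∘ to e) (from e ∘ from (sound A (g xs)))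
      where
        r : Fin (m ℕ.+ size A) → Fin (n ℕ.+ size A)
        r = splice (λ i → f i ↑ˡ size A) (n ↑ʳ_)

    definable-× : ∀ {n} {P Q : Vec V n → Set ℓ} → Definable P → Definable Q → Definable (λ xs → P xs × Q xs)
    definable-× A B = definable params (rename intoˡ (formula A) ∧̇ rename intoʳ (formula B))
      λ xs → mk⇔ (λ (a , b) → to (left xs) a , to (right xs) b)
                 (λ (a , b) → from (left xs) a , from (right xs) b)
      where open Merge A B

    definable-⊎ : ∀ {n} {P Q : Vec V n → Set ℓ} → Definable P → Definable Q → Definable (λ xs → P xs ⊎ Q xs)
    definable-⊎ A B = definable params (rename intoˡ (formula A) ∨̇ rename intoʳ (formula B))
      λ xs → mk⇔ [ inj₁ ∘ to (left xs) , inj₂ ∘ to (right xs) ]′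
                 [ inj₁ ∘ from (left xs) , inj₂ ∘ from (right xs) ]′
      where open Merge A B

    definable-→ : ∀ {n} {P Q : Vec V n → Set ℓ} → Definable P → Definable Q → Definable (λ xs → P xs → Q xs)
    definable-→ A B = definable params (rename intoˡ (formula A) ⇒̇ rename intoʳ (formula B))
      λ xs → mk⇔ (λ h → to (right xs) ∘ h ∘ from (left xs))
                 (λ h → from (right xs) ∘ h ∘ to (left xs))
      where open Merge A B

    definable-¬ : ∀ {n} {P : Vec V n → Set ℓ} → Definable P → Definable (λ xs → ¬ P xs)
    definable-¬ A = definable (par A) (¬̇ formula A)
      λ xs → mk⇔ (_∘ from (sound A xs)) (_∘ to (sound A xs))

    definable-∀ : ∀ {n} {P : Vec V (ℕ.suc n) → Set ℓ} → Definable P → Definable (λ xs → ∀ x → P (x ∷ xs))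
    definable-∀ A = definable (par A) (∀̇ formula A)
      λ xs → mk⇔ (λ h x → to (sound A (x ∷ xs)) (h x)) (λ h x → from (sound A (x ∷ xs)) (h x))

    definable-∃ : ∀ {n} {P : Vec V (ℕ.suc n) → Set ℓ} → Definable P → Definable (λ xs → ∃[ x ] P (x ∷ xs))
    definable-∃ A = definable (par A) (∃̇ formula A)
      λ xs → mk⇔ (λ (x , h) → x , to (sound A (x ∷ xs)) h) (λ (x , h) → x , from (sound A (x ∷ xs)) h)

    definable-∈ : ∀ {n} (i j : Fin n) → Definable (λ xs → lookup xs i ∈ lookup xs j)
    definable-∈ i j = definable [] ((i ↑ˡ 0) ∈̇ (j ↑ˡ 0)) λ xs →
      mk⇔ (subst₂ _∈_ (lookup-++ˡ xs [] i) (lookup-++ˡ xs [] j))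
          (subst₂ _∈_ (sym (lookup-++ˡ xs [] i)) (sym (lookup-++ˡ xs [] j)))

    definable-≡ : ∀ {n} (i j : Fin n) → Definable (λ xs → lookup xs i ≡ lookup xs j)
    definable-≡ i j = definable [] ((i ↑ˡ 0) ≐ (j ↑ˡ 0)) λ xs →
      mk⇔ (subst₂ _≡_ (lookup-++ˡ xs [] i) (lookup-++ˡ xs [] j))
          (subst₂ _≡_ (sym (lookup-++ˡ xs [] i)) (sym (lookup-++ˡ xs [] j)))

    definable-≡-parameter : ∀ {n} (i : Fin n) (c : V) → Definable (λ xs → lookup xs i ≡ c)
    definable-≡-parameter {n} i c = definable (c ∷ []) ((i ↑ˡ 1) ≐ (n ↑ʳ zero)) λ xs →
      mk⇔ (subst₂ _≡_ (lookup-++ˡ xs (c ∷ []) i) (lookup-++ʳ xs (c ∷ []) zero))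
          (subst₂ _≡_ (sym (lookup-++ˡ xs (c ∷ []) i)) (sym (lookup-++ʳ xs (c ∷ []) zero)))

  -- Formulas and terms are built together with their meaning; the latter is a
  -- separate component so that it computes to the intended proposition.
  record Fm (n : ℕ) : Set (Level.suc ℓ) where
    no-eta-equality; pattern
    constructor fm
    field
      sem        : Vec V n → Set ℓ
      definition : Definable sem

  open Fm public

  substitute : ∀ {m n} (f : Fin m → Fin n) (g : Vec V n → Vec V m) →
               (∀ ρ i → lookup ρ (f i) ≡ lookup (g ρ) i) → Fm m → Fm n
  substitute f g h A = fm (sem A ∘ g) (definable-rename f g h (definition A))

  infixr 6 _∧ᶠ_
  infixr 5 _∨ᶠ_
  infixr 4 _⇒ᶠ_
  infix  4 _⇔ᶠ_
  infix  7 ¬ᶠ_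
  infix  3 ∀ᶠ_ ∃ᶠ_

  _∧ᶠ_ _∨ᶠ_ _⇒ᶠ_ _⇔ᶠ_ : ∀ {n} → Fm n → Fm n → Fm n
  A ∧ᶠ B = fm (λ xs → sem A xs × sem B xs) (definable-× (definition A) (definition B))
  A ∨ᶠ B = fm (λ xs → sem A xs ⊎ sem B xs) (definable-⊎ (definition A) (definition B))
  A ⇒ᶠ B = fm (λ xs → sem A xs → sem B xs) (definable-→ (definition A) (definition B))
  A ⇔ᶠ B = fm (λ xs → sem A xs ⇔ sem B xs)
    (definable-⇔ (definition ((A ⇒ᶠ B) ∧ᶠ (B ⇒ᶠ A))) λ xs → mk⇔ (λ (f , g) → mk⇔ f g) (λ e → to e , from e))

  ¬ᶠ_ : ∀ {n} → Fm n → Fm n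
  ¬ᶠ A = fm (λ xs → ¬ sem A xs) (definable-¬ (definition A))

  ∀ᶠ_ ∃ᶠ_ : ∀ {n} → Fm (ℕ.suc n) → Fm n
  ∀ᶠ A = fm (λ xs → ∀ x → sem A (x ∷ xs)) (definable-∀ (definition A))
  ∃ᶠ A = fm (λ xs → ∃[ x ] sem A (x ∷ xs)) (definable-∃ (definition A))

  graphOf : ∀ {n} → (Vec V n → V) → Vec V (ℕ.suc n) → Set ℓ
  graphOf v (y ∷ xs) = y ≡ v xs

  record Tm (n : ℕ) : Set (Level.suc ℓ) where
    no-eta-equality
    constructor tm
    field
      val   : Vec V n → V
      graph : Definable (graphOf val)

  open Tm public

  ignoreHead : ∀ {n} → (Vec V n → V) → Vec V (ℕ.suc n) → V
  ignoreHead v (_ ∷ xs) = v xs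

  dropSecond : ∀ {n} → Vec V (2 ℕ.+ n) → Vec V (1 ℕ.+ n)
  dropSecond (y ∷ _ ∷ xs) = y ∷ xs

  lookup-dropSecond : ∀ {n} (ρ : Vec V (2 ℕ.+ n)) i → lookup ρ (lift suc i) ≡ lookup (dropSecond ρ) i
  lookup-dropSecond (y ∷ x ∷ xs) zero    = refl
  lookup-dropSecond (y ∷ x ∷ xs) (suc i) = refl

  abstract
    weaken-graph : ∀ {n} {v : Vec V n → V} → Definable (graphOf v) →
                   Definable (graphOf (ignoreHead v))
    weaken-graph {v = v} A = definable-⇔ {Q = graphOf (ignoreHead v)} (definable-rename (lift suc) dropSecond lookup-dropSecond A)
      λ { (_ ∷ _ ∷ _) → mk⇔ id id }

    var-graph : ∀ {n} (i : Fin n) → Definable (graphOf λ xs → lookup xs i)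
    var-graph i = definable-⇔ {Q = graphOf (λ xs → lookup xs i)} (definable-≡ zero (suc i)) λ { (_ ∷ _) → mk⇔ id id }

    parameter-graph : ∀ {n} (c : V) → Definable (graphOf {n} λ _ → c)
    parameter-graph c = definable-⇔ {Q = graphOf (λ _ → c)} (definable-≡-parameter zero c) λ { (_ ∷ _) → mk⇔ id id }

    -- The signature has no function symbols, so an operation is substituted through its graph: P (v
    -- xs) becomes ∃ y (y = v xs ∧ P y).
    definable-instance : ∀ {n} {P : Vec V (ℕ.suc n) → Set ℓ} {v : Vec V n → V} →
      Definable P → Definable (graphOf v) → Definable (λ xs → P (v xs ∷ xs))
    definable-instance {P = P} {v} A G = definable-⇔ (definable-∃ (definable-× G A))
      λ xs → mk⇔ (λ { (y , refl , a) → a }) (λ a → v xs , refl , a)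

    -- By Extensionality, y = v xs says that y and v xs have the same elements, so a definition of
    -- membership in v xs suffices. Unordered pairs, intersections, products of the greedy process
    -- and the like become terms in this way.
    extensional-graph : ∀ {n} {P : Vec V (ℕ.suc n) → Set ℓ} {v : Vec V n → V} →
      Definable P → (∀ xs z → z ∈ v xs ⇔ P (z ∷ xs)) → Definable (graphOf v)
    extensional-graph {P = P} {v} A e = definable-⇔
      (definable-∀ (definable-× (definable-→ (definable-∈ zero (suc zero)) A′)
                                (definable-→ A′ (definable-∈ zero (suc zero)))))
      λ { (y ∷ xs) → mk⇔
        (λ h → extensionality y (v xs) λ z →
          mk⇔ (λ p → from (e xs z) (proj₁ (h z) p)) (λ p → proj₂ (h z) (to (e xs z) p)))
        (λ { refl z → to (e xs z) , from (e xs z) }) }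
      where
        A′ : Definable (P ∘ dropSecond)
        A′ = definable-rename (lift suc) dropSecond lookup-dropSecond A

  infix 11 ↑_ `_

  ↑_ : ∀ {n} → Tm n → Tm (ℕ.suc n)
  ↑ t = tm (ignoreHead (val t)) (weaken-graph (graph t))

  var : ∀ {n} → Fin n → Tm n
  var i = tm (λ xs → lookup xs i) (var-graph i)

  #0 : ∀ {n} → Tm (1 ℕ.+ n)
  #1 : ∀ {n} → Tm (2 ℕ.+ n)
  #2 : ∀ {n} → Tm (3 ℕ.+ n)
  #3 : ∀ {n} → Tm (4 ℕ.+ n)
  #4 : ∀ {n} → Tm (5 ℕ.+ n)
  #5 : ∀ {n} → Tm (6 ℕ.+ n)
  #0 = var zero
  #1 = var (suc zero)
  #2 = var (suc (suc zero))
  #3 = var (suc (suc (suc zero)))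
  #4 = var (suc (suc (suc (suc zero))))
  #5 = var (suc (suc (suc (suc (suc zero)))))

  `_ : ∀ {n} → V → Tm n
  ` c = tm (λ _ → c) (parameter-graph c)

  infix 9 _[_]ᶠ

  _[_]ᶠ : ∀ {n} → Fm (ℕ.suc n) → Tm n → Fm n
  A [ t ]ᶠ = fm (λ xs → sem A (val t xs ∷ xs)) (definable-instance (definition A) (graph t))

  infix 8 _∈ᶠ_ _≡ᶠ_

  _∈ᶠ_ _≡ᶠ_ : ∀ {n} → Tm n → Tm n → Fm n
  s ∈ᶠ t = fm _ (definable-∈ (suc zero) zero) [ ↑ t ]ᶠ [ s ]ᶠ
  s ≡ᶠ t = fm _ (graph t) [ s ]ᶠ

  abstract
    sep : Fm 1 → V → V
    sep (fm _ A) a = proj₁ (separation (formula A) (par A) a)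

    ∈-sep : ∀ A a x → x ∈ sep A a ⇔ (x ∈ a × sem A (x ∷ []))
    ∈-sep (fm _ A) a x = mk⇔
      (λ h → let (p , q) = to (proj₂ (separation (formula A) (par A) a) x) h
             in p , to (sound A (x ∷ [])) q)
      (λ (p , q) → from (proj₂ (separation (formula A) (par A) a) x) (p , from (sound A (x ∷ [])) q))

  Functional : Fm 2 → V → Set ℓ
  Functional A a = ∀ x → x ∈ a → ∀ y y′ → sem A (x ∷ y ∷ []) → sem A (x ∷ y′ ∷ []) → y ≡ y′

  abstract
    image : (A : Fm 2) (a : V) → Functional A a →
            ∃[ b ] ∀ y → y ∈ b ⇔ (∃[ x ] x ∈ a × sem A (x ∷ y ∷ []))
    image (fm _ A) a h =
      let (b , e) = replacement (formula A) (par A) a λ x x∈a y y′ p q →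
                      h x x∈a y y′ (to (sound A (x ∷ y ∷ [])) p) (to (sound A (x ∷ y′ ∷ [])) q)
      in b , λ y → mk⇔
        (λ h → let (x , p , q) = to (e y) h in x , p , to (sound A (x ∷ y ∷ [])) q)
        (λ (x , p , q) → from (e y) (x , p , from (sound A (x ∷ y ∷ [])) q))

-- Elementary sets and relations given by formulas

module Sets {ℓ : Level} (M : ZFModel ℓ) where
  open Definability M public

  ∉-∅ : ∀ {z} → ¬ z ∈ ∅
  ∉-∅ {z} = proj₂ emptySet z

  ∈-pair : ∀ {x y z} → z ∈ pair x y ⇔ (z ≡ x ⊎ z ≡ y)
  ∈-pair {x} {y} {z} = proj₂ (pairing x y) z

  ∈-⋃ : ∀ {x z} → z ∈ ⋃ x ⇔ (∃[ y ] y ∈ x × z ∈ y)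
  ∈-⋃ {x} {z} = proj₂ (union x) z

  ext : ∀ {x y} → x ⊆ y → y ⊆ x → x ≡ y
  ext {x} {y} p q = extensionality x y λ z → mk⇔ (p z) (q z)

  pair-comm : ∀ x y → pair x y ≡ pair y x
  pair-comm x y = ext (λ z h → from ∈-pair (swap (to ∈-pair h))) (λ z h → from ∈-pair (swap (to ∈-pair h)))

  infixl 10 _∪_

  _∪_ : V → V → V
  a ∪ b = ⋃ (pair a b)

  ∈-∪ : ∀ {a b z} → z ∈ a ∪ b ⇔ (z ∈ a ⊎ z ∈ b)
  ∈-∪ {a} {b} {z} = mk⇔
    (λ h → case to ∈-⋃ h of λ (y , p , q) →
      [ (λ { refl → inj₁ q }) , (λ { refl → inj₂ q }) ]′ (to ∈-pair p))
    [ (λ q → from ∈-⋃ (a , from ∈-pair (inj₁ refl) , q))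
    , (λ q → from ∈-⋃ (b , from ∈-pair (inj₂ refl) , q)) ]′

  insert : V → V → V
  insert x a = a ∪ singleton x

  ∈-insert : ∀ {x a z} → z ∈ insert x a ⇔ (z ∈ a ⊎ z ≡ x)
  ∈-insert = mk⇔
    (λ h → [ inj₁ , (λ q → inj₂ ([ id , id ]′ (to ∈-pair q))) ]′ (to ∈-∪ h))
    (λ h → from ∈-∪ ([ inj₁ , (λ q → inj₂ (from ∈-pair (inj₁ q))) ]′ h))

  ∈-succ : ∀ {x z} → z ∈ succ x ⇔ (z ∈ x ⊎ z ≡ x)
  ∈-succ = ∈-insert

  singleton-injective : ∀ {x y} → singleton x ≡ singleton y → x ≡ y
  singleton-injective {x} {y} e =
    [ id , id ]′ (to ∈-pair (subst (x ∈_) e (from ∈-pair (inj₁ refl))))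

  ⟨,⟩-injective : ∀ {x y x′ y′} → ⟨ x , y ⟩ ≡ ⟨ x′ , y′ ⟩ → x ≡ x′ × y ≡ y′
  ⟨,⟩-injective {x} {y} {x′} {y′} e = x≡x′ , y≡y′ x≡x′
    where
      singleton-of : ∀ {x a b} → singleton x ≡ pair a b → x ≡ a × x ≡ b
      singleton-of {x} {a} {b} e =
        let f : ∀ {z} → z ∈ pair a b → x ≡ z
            f h = sym ([ id , id ]′ (to ∈-pair (subst (_ ∈_) (sym e) h)))
        in f (from ∈-pair (inj₁ refl)) , f (from ∈-pair (inj₂ refl))
      x≡x′ : x ≡ x′
      x≡x′ with to ∈-pair (subst (singleton x ∈_) e (from ∈-pair (inj₁ refl)))
      ... | inj₁ p = singleton-injective p
      ... | inj₂ p = proj₁ (singleton-of p)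
      other : ∀ {a b c} → pair a b ∈ ⟨ a , c ⟩ → b ≡ a ⊎ b ≡ c
      other {a} {b} {c} h with to ∈-pair h
      ... | inj₁ p = inj₁ (sym (proj₂ (singleton-of (sym p))))
      ... | inj₂ p = to ∈-pair (subst (b ∈_) p (from ∈-pair (inj₂ refl)))
      y≡y′ : x ≡ x′ → y ≡ y′
      y≡y′ refl with other {x} {y} {y′} (subst (pair x y ∈_) e (from ∈-pair (inj₂ refl)))
                   | other {x} {y′} {y} (subst (pair x y′ ∈_) (sym e) (from ∈-pair (inj₂ refl)))
      ... | inj₂ p | _      = p
      ... | inj₁ p | inj₁ q = trans p (sym q)
      ... | inj₁ p | inj₂ q = sym q

  abstract
    𝒫 : V → V
    𝒫 a = proj₁ (powerSet a)

    ∈-𝒫 : ∀ {a z} → z ∈ 𝒫 a ⇔ z ⊆ a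
    ∈-𝒫 {a} {z} = proj₂ (powerSet a) z

  infix 8 _⊆ᶠ_

  _⊆ᶠ_ : ∀ {n} → Tm n → Tm n → Fm n
  s ⊆ᶠ t = ∀ᶠ #0 ∈ᶠ ↑ s ⇒ᶠ #0 ∈ᶠ ↑ t

  abstract
    pair-graph : ∀ {n} (s t : Tm n) → Definable (graphOf λ xs → pair (val s xs) (val t xs))
    pair-graph s t = extensional-graph (definition (#0 ≡ᶠ ↑ s ∨ᶠ #0 ≡ᶠ ↑ t)) (λ _ _ → ∈-pair)

    insert-graph : ∀ {n} (s t : Tm n) → Definable (graphOf λ xs → insert (val s xs) (val t xs))
    insert-graph s t = extensional-graph (definition (#0 ∈ᶠ ↑ t ∨ᶠ #0 ≡ᶠ ↑ s)) (λ _ _ → ∈-insert)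

  pairᵗ ⟨_,_⟩ᵗ insertᵗ : ∀ {n} → Tm n → Tm n → Tm n
  pairᵗ s t = tm _ (pair-graph s t)
  ⟨ s , t ⟩ᵗ = pairᵗ (pairᵗ s s) (pairᵗ s t)
  insertᵗ s t = tm _ (insert-graph s t)

  ∅ᵗ : ∀ {n} → Tm n
  ∅ᵗ = ` ∅

  succᵗ : ∀ {n} → Tm n → Tm n
  succᵗ t = insertᵗ t t

  at₂ : ∀ {n} → Fm 2 → Tm n → Tm n → Fm n
  at₂ A s t = substitute (λ { zero → zero ; (suc i) → suc zero }) (λ { (x ∷ y ∷ _) → x ∷ y ∷ [] })
    (λ { (x ∷ y ∷ _) zero → refl ; (x ∷ y ∷ _) (suc zero) → refl }) A [ ↑ s ]ᶠ [ t ]ᶠ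

  at₃ : ∀ {n} → Fm 3 → Tm n → Tm n → Tm n → Fm n
  at₃ A s t u = substitute (λ { zero → zero ; (suc zero) → suc zero ; (suc (suc i)) → suc (suc zero) })
    (λ { (x ∷ y ∷ z ∷ _) → x ∷ y ∷ z ∷ [] })
    (λ { (x ∷ y ∷ z ∷ _) zero → refl ; (x ∷ y ∷ z ∷ _) (suc zero) → refl ; (x ∷ y ∷ z ∷ _) (suc (suc zero)) → refl })
    A [ ↑ ↑ s ]ᶠ [ ↑ t ]ᶠ [ u ]ᶠ

  abstract
    rel : Fm 2 → V → V → V
    rel A a b = sep (∃ᶠ ∃ᶠ #1 ∈ᶠ ` a ∧ᶠ #0 ∈ᶠ ` b ∧ᶠ #2 ≡ᶠ ⟨ #1 , #0 ⟩ᵗ ∧ᶠ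
                       at₂ A #1 #0)
                    -- A Kuratowski pair of an element of a and an element of b is a set of subsets
                    -- of a ∪ b, so Separation from this set loses no pair.
                    (𝒫 (𝒫 (a ∪ b)))

    ∈-rel : ∀ {A a b p} → p ∈ rel A a b ⇔
            (∃[ x ] ∃[ y ] x ∈ a × y ∈ b × p ≡ ⟨ x , y ⟩ × sem A (x ∷ y ∷ []))
    ∈-rel {A} {a} {b} {p} = mk⇔ (λ h → proj₂ (to (∈-sep _ _ _) h))
      λ { (x , y , x∈a , y∈b , refl , h) → from (∈-sep _ _ _)
          ( from ∈-𝒫 (λ z z∈ → from ∈-𝒫 ([ (λ { refl w w∈ → elems x∈a (inj₁ x∈a) (to ∈-pair w∈) })
                                        , (λ { refl w w∈ → elems x∈a (inj₂ y∈b) (to ∈-pair w∈) }) ]′ (to ∈-pair z∈)))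
          , x , y , x∈a , y∈b , refl , h) }
      where
        elems : ∀ {x y w} → x ∈ a → (y ∈ a ⊎ y ∈ b) → w ≡ x ⊎ w ≡ y → w ∈ a ∪ b
        elems p q (inj₁ refl) = from ∈-∪ (inj₁ p)
        elems p q (inj₂ refl) = from ∈-∪ q

  ↦-rel : ∀ {A a b x y} → rel A a b ∋ x ↦ y ⇔ (x ∈ a × y ∈ b × sem A (x ∷ y ∷ []))
  ↦-rel {A} = mk⇔
    (λ h → let (x , y , p , q , e , s) = to ∈-rel h ; (e₁ , e₂) = ⟨,⟩-injective e in
      subst₂ (λ x y → x ∈ _ × y ∈ _ × sem A (x ∷ y ∷ [])) (sym e₁) (sym e₂) (p , q , s))
    (λ (p , q , s) → from ∈-rel (_ , _ , p , q , refl , s))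

  infix 8 _↦ᶠ_∈_
  _↦ᶠ_∈_ : ∀ {n} → Tm n → Tm n → Tm n → Fm n
  x ↦ᶠ y ∈ f = ⟨ x , y ⟩ᵗ ∈ᶠ f

-- Ordinals

module Ordinals {ℓ : Level} (em : ExcludedMiddle ℓ) (M : ZFModel ℓ) where
  open Sets M public

  by-contradiction : {P : Set ℓ} → ¬ ¬ P → P
  by-contradiction = decidable-stable em

  ∈-irrefl : ∀ {x} → ¬ x ∈ x
  ∈-irrefl {x} h with foundation (singleton x) (x , from ∈-pair (inj₁ refl))
  ... | y , y∈ , k with to ∈-pair y∈
  ... | inj₁ refl = k x y∈ h
  ... | inj₂ refl = k x y∈ h

  ∈-asym : ∀ {x y} → x ∈ y → ¬ y ∈ x
  ∈-asym {x} {y} p q with foundation (pair x y) (x , from ∈-pair (inj₁ refl))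
  ... | z , z∈ , k with to ∈-pair z∈
  ... | inj₁ refl = k y (from ∈-pair (inj₂ refl)) q
  ... | inj₂ refl = k x (from ∈-pair (inj₁ refl)) p

  abstract
    minimal : (A : Fm 1) (a : V) → (∃[ x ] x ∈ a × sem A (x ∷ [])) →
              ∃[ m ] m ∈ a × sem A (m ∷ []) × (∀ z → z ∈ a → z ∈ m → ¬ sem A (z ∷ []))
    minimal A a (x , p , q) with foundation (sep A a) (x , from (∈-sep A a x) (p , q))
    ... | m , m∈ , k with to (∈-sep A a m) m∈
    ... | m∈a , s = m , m∈a , s , λ z z∈a z∈m t → k z (from (∈-sep A a z) (z∈a , t)) z∈m

  open WellOrderedBy∈

  ⊆-wellOrdered : ∀ {a b} → b ⊆ a → WellOrderedBy∈ a → WellOrderedBy∈ b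
  ⊆-wellOrdered s w = record
    { irreflexive  = λ x p → irreflexive w x (s x p)
    ; transitive   = λ x y z p q r → transitive w x y z (s x p) (s y q) (s z r)
    ; trichotomous = λ x y p q → trichotomous w x y (s x p) (s y q)
    ; least        = λ b b⊆ → least w b (λ z → s z ∘ b⊆ z)
    }

  member-ordinal : ∀ {α x} → IsOrdinal α → x ∈ α → IsOrdinal x
  member-ordinal {α} {x} (t , w) x∈α =
    (λ y y∈x z z∈y → transitive w z y x (t y (t x x∈α y y∈x) z z∈y) (t x x∈α y y∈x) x∈α z∈y y∈x) ,
    ⊆-wellOrdered (t x x∈α) w

  -- The least m in β outside α equals α. By minimality m ⊆ α, and an element of α not below m would
  -- put m into the transitive set α.
  ordinal-⊊ : ∀ {α β} → IsTransitive α → IsOrdinal β → α ⊆ β → α ≢ β → α ∈ β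
  ordinal-⊊ {α} {β} tα (tβ , wβ) α⊆β α≢β with em {∃[ x ] x ∈ β × ¬ x ∈ α}
  ... | no h = ⊥-elim (α≢β (ext α⊆β λ x x∈β → by-contradiction λ x∉α → h (x , x∈β , x∉α)))
  ... | yes h with minimal (¬ᶠ #0 ∈ᶠ ` α) β h
  ... | m , m∈β , m∉α , k = subst (_∈ β) m≡α m∈β
    where
      below : ∀ {z} → z ∈ α → z ∈ m
      below {z} z∈α with trichotomous wβ z m (α⊆β z z∈α) m∈β
      ... | inj₁ p = p
      ... | inj₂ (inj₁ refl) = ⊥-elim (m∉α z∈α)
      ... | inj₂ (inj₂ p) = ⊥-elim (m∉α (tα z z∈α m p))
      m≡α : m ≡ α
      m≡α = ext (λ z z∈m → by-contradiction (k z (tβ m m∈β z z∈m) z∈m)) (λ z → below)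

  abstract
    -- The intersection γ is transitive. If it differed from both α and β, it would belong to both
    -- by `ordinal-⊊`, hence to itself.
    trichotomy : ∀ {α β} → IsOrdinal α → IsOrdinal β → α ∈ β ⊎ α ≡ β ⊎ β ∈ α
    trichotomy {α} {β} oα@(tα , _) oβ@(tβ , _) = compare em em
      where
        γ : V
        γ = sep (#0 ∈ᶠ ` β) α
        ∈γ : ∀ {z} → z ∈ γ ⇔ (z ∈ α × z ∈ β)
        ∈γ {z} = ∈-sep _ α z
        tγ : IsTransitive γ
        tγ y y∈ z z∈ = let (p , q) = to ∈γ y∈ in from ∈γ (tα y p z z∈ , tβ y q z z∈)
        γ∈ : ∀ {δ} → IsOrdinal δ → γ ⊆ δ → γ ≢ δ → γ ∈ δ
        γ∈ = ordinal-⊊ tγ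
        γ⊆α : γ ⊆ α
        γ⊆α z = proj₁ ∘ to ∈γ
        γ⊆β : γ ⊆ β
        γ⊆β z = proj₂ ∘ to ∈γ
        compare : Dec (γ ≡ α) → Dec (γ ≡ β) → α ∈ β ⊎ α ≡ β ⊎ β ∈ α
        compare (yes p) (yes q) = inj₂ (inj₁ (trans (sym p) q))
        compare (yes p) (no q)  = inj₁ (subst (_∈ β) p (γ∈ oβ γ⊆β q))
        compare (no p)  (yes q) = inj₂ (inj₂ (subst (_∈ α) q (γ∈ oα γ⊆α p)))
        compare (no p)  (no q)  = ⊥-elim (∈-irrefl (from ∈γ (γ∈ oα γ⊆α p , γ∈ oβ γ⊆β q)))

  -- Foundation supplies irreflexivity and least elements. What remains quantifies over elements
  -- only and yields the formula for ordinals.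
  ordinal-criterion : ∀ {α} → IsOrdinal α ⇔
    ((∀ x → x ∈ α → x ⊆ α) × (∀ x → x ∈ α → ∀ y → y ∈ x → y ⊆ x) ×
     (∀ x → x ∈ α → ∀ y → y ∈ α → x ∈ y ⊎ x ≡ y ⊎ y ∈ x))
  ordinal-criterion {α} = mk⇔
    (λ o@(t , w) → t , (λ x x∈α → proj₁ (member-ordinal o x∈α)) ,
      λ x x∈α y y∈α → trichotomous w x y x∈α y∈α)
    (λ (t , h , tri) → t , record
      { irreflexive  = λ _ _ → ∈-irrefl
      ; transitive   = λ x y z _ _ z∈α x∈y y∈z → h z z∈α y y∈z x x∈y
      ; trichotomous = λ x y x∈α y∈α → tri x x∈α y y∈α
      ; least        = λ b b⊆α ne → case foundation b ne of λ (m , m∈b , k) →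
          m , m∈b , λ x x∈b → case tri m (b⊆α m m∈b) x (b⊆α x x∈b) of λ
            { (inj₁ p) → inj₂ p ; (inj₂ (inj₁ p)) → inj₁ p ; (inj₂ (inj₂ p)) → ⊥-elim (k x x∈b p) }
      })

  ordinal : ∀ {α} → IsTransitive α → (∀ x → x ∈ α → IsOrdinal x) → IsOrdinal α
  ordinal {α} t o = from ordinal-criterion
    (t , (λ x x∈α → proj₁ (o x x∈α)) , λ x x∈α y y∈α → trichotomy (o x x∈α) (o y y∈α))

  abstract
    ordinal-definable : ∀ {n} (t : Tm n) → Definable (λ xs → IsOrdinal (val t xs))
    ordinal-definable t = definable-⇔ (definition (
      (∀ᶠ #0 ∈ᶠ ↑ t ⇒ᶠ #0 ⊆ᶠ ↑ t) ∧ᶠ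
      (∀ᶠ #0 ∈ᶠ ↑ t ⇒ᶠ (∀ᶠ #0 ∈ᶠ #1 ⇒ᶠ #0 ⊆ᶠ #1)) ∧ᶠ
      (∀ᶠ #0 ∈ᶠ ↑ t ⇒ᶠ (∀ᶠ #0 ∈ᶠ ↑ ↑ t ⇒ᶠ #1 ∈ᶠ #0 ∨ᶠ #1 ≡ᶠ #0 ∨ᶠ #0 ∈ᶠ #1))))
      λ xs → mk⇔ (from ordinal-criterion) (to ordinal-criterion)

  ordinalᶠ : ∀ {n} → Tm n → Fm n
  ordinalᶠ t = fm _ (ordinal-definable t)

  ⊆-or-∋ : ∀ {α β} → IsOrdinal α → IsOrdinal β → α ⊆ β ⊎ β ∈ α
  ⊆-or-∋ oα oβ with trichotomy oα oβ
  ... | inj₁ p = inj₁ (proj₁ oβ _ p)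
  ... | inj₂ (inj₁ refl) = inj₁ (λ _ → id)
  ... | inj₂ (inj₂ p) = inj₂ p

  ⊆-total : ∀ {α β} → IsOrdinal α → IsOrdinal β → α ⊆ β ⊎ β ⊆ α
  ⊆-total oα oβ with ⊆-or-∋ oα oβ
  ... | inj₁ p = inj₁ p
  ... | inj₂ p = inj₂ (proj₁ oα _ p)

  ⊆⇒≤ : ∀ {α β} → IsOrdinal α → IsOrdinal β → α ⊆ β → α ≤ₒ β
  ⊆⇒≤ {α} {β} oα oβ s with em {α ≡ β}
  ... | yes p = inj₁ p
  ... | no p  = inj₂ (ordinal-⊊ (proj₁ oα) oβ s p)

  ⊆-∈-trans : ∀ {α β γ} → IsOrdinal α → IsOrdinal γ → α ⊆ β → β ∈ γ → α ∈ γ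
  ⊆-∈-trans oα oγ s β∈γ with ⊆⇒≤ oα (member-ordinal oγ β∈γ) s
  ... | inj₁ refl = β∈γ
  ... | inj₂ p    = proj₁ oγ _ β∈γ _ p

  succ-ordinal : ∀ {α} → IsOrdinal α → IsOrdinal (succ α)
  succ-ordinal {α} oα = ordinal
    (λ y y∈ z z∈y → from ∈-succ (inj₁ ([ (λ p → proj₁ oα y p z z∈y) , (λ { refl → z∈y }) ]′ (to ∈-succ y∈))))
    (λ x x∈ → [ member-ordinal oα , (λ { refl → oα }) ]′ (to ∈-succ x∈))

  ∈-succ-self : ∀ {x} → x ∈ succ x
  ∈-succ-self = from ∈-succ (inj₂ refl)

  succ≢∅ : ∀ {x} → succ x ≢ ∅
  succ≢∅ {x} e = ∉-∅ (subst (x ∈_) e ∈-succ-self)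

  succ-injective : ∀ {x y} → succ x ≡ succ y → x ≡ y
  succ-injective {x} {y} e with to ∈-succ (subst (x ∈_) e ∈-succ-self) | to ∈-succ (subst (y ∈_) (sym e) ∈-succ-self)
  ... | inj₂ p | _      = p
  ... | inj₁ _ | inj₂ q = sym q
  ... | inj₁ p | inj₁ q = ⊥-elim (∈-asym p q)

  ∅-ordinal : IsOrdinal ∅
  ∅-ordinal = ordinal (λ _ p → ⊥-elim (∉-∅ p)) (λ _ p → ⊥-elim (∉-∅ p))

  abstract
    ordinal-induction : (A : Fm 1) →
      (∀ α → IsOrdinal α → (∀ β → β ∈ α → sem A (β ∷ [])) → sem A (α ∷ [])) →
      ∀ α → IsOrdinal α → sem A (α ∷ [])
    ordinal-induction A step α oα = by-contradiction λ ¬Aα →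
      case minimal (¬ᶠ A) (succ α) (α , ∈-succ-self , ¬Aα) of λ (m , m∈ , ¬Am , k) →
      let o = member-ordinal (succ-ordinal oα) m∈ in
      ¬Am (step m o λ β β∈m → by-contradiction (k β (proj₁ (succ-ordinal oα) m m∈ β β∈m) β∈m))

-- Bijections and comparison of sizes

module Cardinality {ℓ : Level} (em : ExcludedMiddle ℓ) (M : ZFModel ℓ) where
  open Ordinals em M public

  module _ {D C : Class} {f : V} (isF : IsFunction D C f) where
    function-dom : ∀ {x y} → f ∋ x ↦ y → D x × C y
    function-dom {x} {y} h with proj₁ isF _ h
    ... | x′ , y′ , d , c , e with ⟨,⟩-injective e
    ... | refl , refl = d , c

    function-value : ∀ {x} → D x → ∃[ y ] C y × f ∋ x ↦ y
    function-value {x} d with proj₂ isF x d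
    ... | y , h , _ = y , proj₂ (function-dom h) , h

    function-unique : ∀ {x y y′} → f ∋ x ↦ y → f ∋ x ↦ y′ → y ≡ y′
    function-unique {x} h h′ with proj₂ isF x (proj₁ (function-dom h))
    ... | _ , _ , u = trans (sym (u h)) (u h′)

  module _ {a b f : V} (bij : IsBijection a b f) where
    bijection-onto : ∀ {y} → y ∈ b → ∃[ x ] x ∈ a × f ∋ x ↦ y
    bijection-onto {y} y∈b with proj₂ bij y y∈b
    ... | x , h , _ = x , proj₁ (function-dom (proj₁ bij) h) , h

    bijection-injective : ∀ {x x′ y} → f ∋ x ↦ y → f ∋ x′ ↦ y → x ≡ x′
    bijection-injective {y = y} h h′ with proj₂ bij y (proj₂ (function-dom (proj₁ bij) h))
    ... | _ , _ , u = trans (sym (u h)) (u h′)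

  unique : {B : V → Set ℓ} → ∀ x → B x → (∀ y → B y → x ≡ y) → ∃! _≡_ B
  unique x b u = x , b , λ {y} → u y

  rel-bijection : ∀ {a b} (A : Fm 2) →
    (∀ x → x ∈ a → ∃[ y ] y ∈ b × sem A (x ∷ y ∷ [])) →
    (∀ y → y ∈ b → ∃[ x ] x ∈ a × sem A (x ∷ y ∷ [])) →
    (∀ x y y′ → x ∈ a → y ∈ b → y′ ∈ b → sem A (x ∷ y ∷ []) → sem A (x ∷ y′ ∷ []) → y ≡ y′) →
    (∀ x x′ y → x ∈ a → x′ ∈ a → y ∈ b → sem A (x ∷ y ∷ []) → sem A (x′ ∷ y ∷ []) → x ≡ x′) →
    IsBijection a b (rel A a b)
  rel-bijection A total onto functional injective =
    ( (λ p h → case to ∈-rel h of λ (x , y , x∈ , y∈ , e , _) → x , y , x∈ , y∈ , e)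
    , λ x x∈ → case total x x∈ of λ (y , y∈ , s) → unique y (from ↦-rel (x∈ , y∈ , s))
        λ y′ h → case to ↦-rel h of λ (_ , y′∈ , s′) → functional x y y′ x∈ y∈ y′∈ s s′ )
    , λ y y∈ → case onto y y∈ of λ (x , x∈ , s) → unique x (from ↦-rel (x∈ , y∈ , s))
        λ x′ h → case to ↦-rel h of λ (x′∈ , _ , s′) → injective x x′ y x∈ x′∈ y∈ s s′

  abstract
    ≈-sym : ∀ {a b} → a ≈ b → b ≈ a
    ≈-sym {a} {b} (f , bij) = rel A _ _ , rel-bijection A
      (λ y y∈ → bijection-onto bij y∈)
      (λ x x∈ → function-value (proj₁ bij) x∈)
      (λ _ _ _ _ _ _ → bijection-injective bij)
      (λ _ _ _ _ _ _ → function-unique (proj₁ bij))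
      where
        A : Fm 2
        A = #1 ↦ᶠ #0 ∈ ` f

  abstract
    ≈-trans : ∀ {a b c} → a ≈ b → b ≈ c → a ≈ c
    ≈-trans (f , bij) (g , bij′) = rel A _ _ , rel-bijection A
      (λ x x∈ → case function-value (proj₁ bij) x∈ of λ (y , y∈ , p) →
        case function-value (proj₁ bij′) y∈ of λ (z , z∈ , q) → z , z∈ , y , p , q)
      (λ z z∈ → case bijection-onto bij′ z∈ of λ (y , y∈ , q) →
        case bijection-onto bij y∈ of λ (x , x∈ , p) → x , x∈ , y , p , q)
      (λ { _ _ _ _ _ _ (y , p , q) (y′ , p′ , q′) →
        case function-unique (proj₁ bij) p p′ of λ { refl → function-unique (proj₁ bij′) q q′ } })
      (λ { _ _ _ _ _ _ (y , p , q) (y′ , p′ , q′) →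
        case bijection-injective bij′ q q′ of λ { refl → bijection-injective bij p p′ } })
      where
        A : Fm 2
        A = ∃ᶠ #1 ↦ᶠ #0 ∈ ` f ∧ᶠ #0 ↦ᶠ #2 ∈ ` g

  infix 4 _≼_

  -- Codes of an element of a in b need not be unique; so a ≼ b says that a is
  -- the image of a subset of b, which without choice is weaker than the
  -- existence of an injection unless b is well-orderable.
  _≼_ : V → V → Set ℓ
  a ≼ b = ∃[ r ] (∀ x → x ∈ a → ∃[ y ] y ∈ b × r ∋ x ↦ y) ×
                 (∀ x x′ y → x ∈ a → x′ ∈ a → r ∋ x ↦ y → r ∋ x′ ↦ y → x ≡ x′)

  abstract
    ≼-definable : ∀ {n} (s t : Tm n) → Definable (λ xs → val s xs ≼ val t xs)
    ≼-definable s t = definition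
      (∃ᶠ (∀ᶠ #0 ∈ᶠ ↑ ↑ s ⇒ᶠ (∃ᶠ #0 ∈ᶠ ↑ ↑ ↑ t ∧ᶠ #1 ↦ᶠ #0 ∈ #2)) ∧ᶠ
          (∀ᶠ ∀ᶠ ∀ᶠ #2 ∈ᶠ ↑ ↑ ↑ ↑ s ⇒ᶠ #1 ∈ᶠ ↑ ↑ ↑ ↑ s ⇒ᶠ
             #2 ↦ᶠ #0 ∈ #3 ⇒ᶠ #1 ↦ᶠ #0 ∈ #3 ⇒ᶠ #2 ≡ᶠ #1))

  ≼ᶠ : ∀ {n} → Tm n → Tm n → Fm n
  ≼ᶠ s t = fm _ (≼-definable s t)

  abstract
    rel-≼ : ∀ {a b} (A : Fm 2) →
      (∀ x → x ∈ a → ∃[ y ] y ∈ b × sem A (x ∷ y ∷ [])) →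
      (∀ x x′ y → x ∈ a → x′ ∈ a → y ∈ b → sem A (x ∷ y ∷ []) → sem A (x′ ∷ y ∷ []) → x ≡ x′) →
      a ≼ b
    rel-≼ {a} {b} A total injective = rel A a b ,
      (λ x x∈ → case total x x∈ of λ (y , y∈ , s) → y , y∈ , from ↦-rel (x∈ , y∈ , s)) ,
      λ x x′ y x∈ x′∈ h h′ → let (_ , y∈ , s) = to ↦-rel h ; (_ , _ , s′) = to ↦-rel h′ in
        injective x x′ y x∈ x′∈ y∈ s s′

  ⊆⇒≼ : ∀ {a b} → a ⊆ b → a ≼ b
  ⊆⇒≼ s = rel-≼ (#0 ≡ᶠ #1) (λ x x∈ → x , s x x∈ , refl) (λ { _ _ _ _ _ _ refl refl → refl })

  abstract
    ≼-trans : ∀ {a b c} → a ≼ b → b ≼ c → a ≼ c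
    ≼-trans {b = b} (r , t , i) (r′ , t′ , i′) = rel-≼ (∃ᶠ #0 ∈ᶠ ` b ∧ᶠ #1 ↦ᶠ #0 ∈ ` r ∧ᶠ #0 ↦ᶠ #2 ∈ ` r′)
      (λ x x∈ → case t x x∈ of λ (y , y∈ , p) → case t′ y y∈ of λ (z , z∈ , q) → z , z∈ , y , y∈ , p , q)
      (λ { x x′ z x∈ x′∈ _ (y , y∈ , p , q) (y′ , y′∈ , p′ , q′) →
        case i′ y y′ z y∈ y′∈ q q′ of λ { refl → i x x′ y x∈ x′∈ p p′ } })

  ≈⇒≼ : ∀ {a b} → a ≈ b → a ≼ b
  ≈⇒≼ (f , bij) = f , (λ x x∈ → function-value (proj₁ bij) x∈) ,
    λ _ _ _ _ _ → bijection-injective bij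

  ≈⇒≽ : ∀ {a b} → a ≈ b → b ≼ a
  ≈⇒≽ = ≈⇒≼ ∘ ≈-sym

  abstract
    infixr 11 _⊗_

    _⊗_ : V → V → V
    a ⊗ b = rel (#0 ≡ᶠ #0) a b

    ∈-⊗ : ∀ {a b p} → p ∈ a ⊗ b ⇔ (∃[ x ] ∃[ y ] x ∈ a × y ∈ b × p ≡ ⟨ x , y ⟩)
    ∈-⊗ = mk⇔ (λ h → case to ∈-rel h of λ (x , y , x∈ , y∈ , e , _) → x , y , x∈ , y∈ , e)
              (λ (x , y , x∈ , y∈ , e) → from ∈-rel (x , y , x∈ , y∈ , e , refl))

    ⟨,⟩∈-⊗ : ∀ {a b x y} → ⟨ x , y ⟩ ∈ a ⊗ b ⇔ (x ∈ a × y ∈ b)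
    ⟨,⟩∈-⊗ = mk⇔ (λ h → case to ↦-rel h of λ (x∈ , y∈ , _) → x∈ , y∈)
                 (λ (x∈ , y∈) → from ↦-rel (x∈ , y∈ , refl))

  ⊗-mono : ∀ {a a′ b b′} → a ≼ a′ → b ≼ b′ → a ⊗ b ≼ a′ ⊗ b′
  ⊗-mono {a} {a′} {b} {b′} (r , t , i) (r′ , t′ , i′) =
    rel-≼ (∃ᶠ ∃ᶠ ∃ᶠ ∃ᶠ #3 ∈ᶠ ` a ∧ᶠ #2 ∈ᶠ ` b ∧ᶠ #4 ≡ᶠ ⟨ #3 , #2 ⟩ᵗ ∧ᶠ
             #5 ≡ᶠ ⟨ #1 , #0 ⟩ᵗ ∧ᶠ
             #3 ↦ᶠ #1 ∈ ` r ∧ᶠ #2 ↦ᶠ #0 ∈ ` r′)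
      (λ p p∈ → case to ∈-⊗ p∈ of λ (x , y , x∈ , y∈ , e) →
        case t x x∈ of λ (u , u∈ , h) → case t′ y y∈ of λ (v , v∈ , h′) →
        ⟨ u , v ⟩ , from ⟨,⟩∈-⊗ (u∈ , v∈) , x , y , u , v , x∈ , y∈ , e , refl , h , h′)
      λ { _ _ _ _ _ _ (x , y , u , v , x∈ , y∈ , refl , refl , h , h′)
                      (x₁ , y₁ , u₁ , v₁ , x₁∈ , y₁∈ , refl , e , k , k′) →
        case ⟨,⟩-injective e of λ { (refl , refl) →
        cong₂ ⟨_,_⟩ (i x x₁ u x∈ x₁∈ h k) (i′ y y₁ v y∈ y₁∈ h′ k′) } }

-- The set ω and ranks in well-orders

module OrderTypes {ℓ : Level} (em : ExcludedMiddle ℓ) (M : ZFModel ℓ) where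
  open Cardinality em M public

  inductiveᶠ : ∀ {n} → Tm n → Fm n
  inductiveᶠ t = ∅ᵗ ∈ᶠ t ∧ᶠ (∀ᶠ #0 ∈ᶠ ↑ t ⇒ᶠ succᵗ #0 ∈ᶠ ↑ t)

  abstract
    ω : V
    ω = sep (∀ᶠ inductiveᶠ #0 ⇒ᶠ #1 ∈ᶠ #0) (proj₁ infinity)

    ∈-ω : ∀ {n} → n ∈ ω ⇔ IsNatural n
    ∈-ω {n} = mk⇔ (λ h → proj₂ (to (∈-sep _ _ n) h))
      (λ h → from (∈-sep _ _ n) (h _ (proj₂ infinity) , h))

  ∅∈ω : ∅ ∈ ω
  ∅∈ω = from ∈-ω λ _ → proj₁

  succ∈ω : ∀ {n} → n ∈ ω → succ n ∈ ω
  succ∈ω h = from ∈-ω λ I i → proj₂ i _ (to ∈-ω h I i)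

  ω-induction : (A : Fm 1) → sem A (∅ ∷ []) → (∀ n → n ∈ ω → sem A (n ∷ []) → sem A (succ n ∷ [])) →
                ∀ n → n ∈ ω → sem A (n ∷ [])
  ω-induction A z s n h = proj₂ (to (∈-sep A ω n) (to ∈-ω h (sep A ω)
    ( from (∈-sep A ω ∅) (∅∈ω , z)
    , λ m m∈ → let (m∈ω , a) = to (∈-sep A ω m) m∈ in from (∈-sep A ω (succ m)) (succ∈ω m∈ω , s m m∈ω a) )))

  ω-cases : ∀ {n} → n ∈ ω → n ≡ ∅ ⊎ (∃[ k ] k ∈ ω × n ≡ succ k)
  ω-cases h = ω-induction (#0 ≡ᶠ ∅ᵗ ∨ᶠ (∃ᶠ #0 ∈ᶠ ` ω ∧ᶠ #1 ≡ᶠ succᵗ #0))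
    (inj₁ refl) (λ n n∈ _ → inj₂ (n , n∈ , refl)) _ h

  ω-ordinal : IsOrdinal ω
  ω-ordinal = ordinal
    (ω-induction (#0 ⊆ᶠ ` ω) (λ z p → ⊥-elim (∉-∅ p))
      (λ n n∈ s z z∈ → [ s z , (λ { refl → n∈ }) ]′ (to ∈-succ z∈)))
    (ω-induction (ordinalᶠ #0) ∅-ordinal (λ n _ → succ-ordinal))

  Bisimulation : V → V → Set ℓ
  Bisimulation R b = ∀ y v → b ∋ y ↦ v →
    (∀ z → R ∋ z ↦ y → ∃[ w ] w ∈ v × b ∋ z ↦ w) ×
    (∀ w → w ∈ v → ∃[ z ] R ∋ z ↦ y × b ∋ z ↦ w)

  -- The value v at y of the Mostowski collapse of R, obtained without
  -- recursion: y and v are related by a bisimulation between R and ∈.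
  Rank : V → V → V → Set ℓ
  Rank R y v = IsOrdinal v × ∃[ b ] Bisimulation R b × b ∋ y ↦ v

  bisimulationᶠ : ∀ {n} → Tm n → Tm n → Fm n
  bisimulationᶠ R b = ∀ᶠ ∀ᶠ #1 ↦ᶠ #0 ∈ ↑ ↑ b ⇒ᶠ
    (∀ᶠ #0 ↦ᶠ #2 ∈ ↑ ↑ ↑ R ⇒ᶠ (∃ᶠ #0 ∈ᶠ #2 ∧ᶠ #1 ↦ᶠ #0 ∈ ↑ ↑ ↑ ↑ b)) ∧ᶠ
    (∀ᶠ #0 ∈ᶠ #1 ⇒ᶠ (∃ᶠ #0 ↦ᶠ #3 ∈ ↑ ↑ ↑ ↑ R ∧ᶠ #0 ↦ᶠ #1 ∈ ↑ ↑ ↑ ↑ b))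

  abstract
    rank-definable : ∀ {n} (R y v : Tm n) → Definable (λ xs → Rank (val R xs) (val y xs) (val v xs))
    rank-definable R y v = definition (ordinalᶠ v ∧ᶠ (∃ᶠ bisimulationᶠ (↑ R) #0 ∧ᶠ ↑ y ↦ᶠ ↑ v ∈ #0))

  rankᶠ : ∀ {n} → Tm n → Tm n → Tm n → Fm n
  rankᶠ R y v = fm _ (rank-definable R y v)

  abstract
    -- Induction along the ordinal v, for arbitrary R: the members of either value are the values at
    -- R-predecessors of y, and those agree by the induction hypothesis.
    rank-unique : ∀ {R y v v′} → Rank R y v → Rank R y v′ → v ≡ v′
    rank-unique {R} {y} {v} {v′} (o , b , bis , h) (_ , b′ , bis′ , h′) =
      ordinal-induction (∀ᶠ ∀ᶠ #1 ↦ᶠ #2 ∈ ` b ⇒ᶠ #1 ↦ᶠ #0 ∈ ` b′ ⇒ᶠ #2 ≡ᶠ #0) step v o y v′ h h′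
      where
        step : ∀ v → IsOrdinal v → (∀ w → w ∈ v → ∀ y w′ → b ∋ y ↦ w → b′ ∋ y ↦ w′ → w ≡ w′) →
               ∀ y v′ → b ∋ y ↦ v → b′ ∋ y ↦ v′ → v ≡ v′
        step v _ ih y v′ h h′ = ext
          (λ w w∈v → case proj₂ (bis y v h) w w∈v of λ (z , zRy , p) →
            case proj₁ (bis′ y v′ h′) z zRy of λ (w′ , w′∈v′ , q) → subst (_∈ v′) (sym (ih w w∈v z w′ p q)) w′∈v′)
          (λ w′ w′∈v′ → case proj₂ (bis′ y v′ h′) w′ w′∈v′ of λ (z , zRy , q) →
            case proj₁ (bis y v h) z zRy of λ (w , w∈v , p) → subst (_∈ v) (ih w w∈v z w′ p q) w∈v)

  rank-pred : ∀ {R y v z} → Rank R y v → R ∋ z ↦ y → ∃[ w ] w ∈ v × Rank R z w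
  rank-pred (o , b , bis , h) zRy with proj₁ (bis _ _ h) _ zRy
  ... | w , w∈v , p = w , w∈v , member-ordinal o w∈v , b , bis , p

  rank-onto : ∀ {R y v w} → Rank R y v → w ∈ v → ∃[ z ] R ∋ z ↦ y × Rank R z w
  rank-onto (o , b , bis , h) w∈v with proj₂ (bis _ _ h) _ w∈v
  ... | z , zRy , p = z , zRy , member-ordinal o w∈v , b , bis , p

  rank-mono : ∀ {R y z v w} → R ∋ z ↦ y → Rank R z w → Rank R y v → w ∈ v
  rank-mono zRy rz ry with rank-pred ry zRy
  ... | w , w∈v , rz′ = subst (_∈ _) (rank-unique rz′ rz) w∈v

  record IsWellOrder (a R : V) : Set ℓ where
    field
      domain     : ∀ {x y} → R ∋ x ↦ y → x ∈ a × y ∈ a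
      transitive : ∀ {x y z} → R ∋ x ↦ y → R ∋ y ↦ z → R ∋ x ↦ z
      connected  : ∀ {x y} → x ∈ a → y ∈ a → R ∋ x ↦ y ⊎ x ≡ y ⊎ R ∋ y ↦ x
      founded    : ∀ b → b ⊆ a → (∃[ x ] x ∈ b) → ∃[ m ] m ∈ b × (∀ x → x ∈ b → ¬ R ∋ x ↦ m)

  module _ {a R : V} (wo : IsWellOrder a R) where
    open IsWellOrder wo

    module _ (m : V) (ranks : ∀ z → R ∋ z ↦ m → ∃[ v ] Rank R z v)
             (v : V) (∈v : ∀ w → w ∈ v ⇔ (∃[ z ] z ∈ a × R ∋ z ↦ m × Rank R z w)) where
      private
        v-intro : ∀ {z w} → R ∋ z ↦ m → Rank R z w → w ∈ v
        v-intro zRm r = from (∈v _) (_ , proj₁ (domain zRm) , zRm , r)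

        ov : IsOrdinal v
        ov = ordinal
          (λ w w∈ t t∈w → case to (∈v w) w∈ of λ (z , _ , zRm , r) →
            case rank-onto r t∈w of λ (u , uRz , r′) → v-intro (transitive uRz zRm) r′)
          (λ w w∈ → case to (∈v w) w∈ of λ (_ , _ , _ , r) → proj₁ r)

        abstract
          b : V
          b = rel (#0 ↦ᶠ ` m ∈ ` R ∧ᶠ rankᶠ (` R) #0 #1 ∨ᶠ #0 ≡ᶠ ` m ∧ᶠ #1 ≡ᶠ ` v) (insert m a) (succ v)

          ∈b : ∀ {z w} → b ∋ z ↦ w ⇔ ((R ∋ z ↦ m × Rank R z w) ⊎ (z ≡ m × w ≡ v))
          ∈b = mk⇔ (λ h → proj₂ (proj₂ (to ↦-rel h))) λ
            { (inj₁ (zRm , r)) → from ↦-rel (from ∈-insert (inj₁ (proj₁ (domain zRm))) ,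
                from ∈-succ (inj₁ (v-intro zRm r)) , inj₁ (zRm , r))
            ; (inj₂ (refl , refl)) → from ↦-rel (from ∈-insert (inj₂ refl) , ∈-succ-self , inj₂ (refl , refl)) }

        bis : Bisimulation R b
        bis y w h with to ∈b h
        ... | inj₁ (yRm , r) =
          (λ z zRy → case rank-pred r zRy of λ (t , t∈w , r′) →
            t , t∈w , from ∈b (inj₁ (transitive zRy yRm , r′))) ,
          (λ t t∈w → case rank-onto r t∈w of λ (z , zRy , r′) →
            z , zRy , from ∈b (inj₁ (transitive zRy yRm , r′)))
        ... | inj₂ (refl , refl) =
          (λ z zRm → case ranks z zRm of λ (t , r) → t , v-intro zRm r , from ∈b (inj₁ (zRm , r))) ,
          (λ t t∈v → case to (∈v t) t∈v of λ (z , _ , zRm , r) → z , zRm , from ∈b (inj₁ (zRm , r)))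

      -- The bisimulation `b` contains all ranks of predecessors of m, together with the pair of m
      -- and v. Taking all of them avoids choosing one bisimulation for each predecessor.
      rank-sup : Rank R m v
      rank-sup = ov , b , bis , from ∈b (inj₂ (refl , refl))

    abstract
      -- A minimal point without a rank has ranked predecessors. Replacement, whose functionality
      -- condition is `rank-unique`, collects their ranks into a set v, and `rank-sup` makes v the
      -- rank of that point.
      rank-exists : ∀ {y} → y ∈ a → ∃[ v ] Rank R y v
      rank-exists {y} y∈a = by-contradiction λ noRank →
        case founded (sep (¬ᶠ hasRank) a) (λ z → proj₁ ∘ to (∈-sep _ a z)) (y , from (∈-sep _ a y) (y∈a , noRank))
        of λ (m , m∈ , least) → proj₂ (to (∈-sep _ a m) m∈) (rank-of m λ z zRm →
          by-contradiction λ none → least z (from (∈-sep _ a z) (proj₁ (domain zRm) , none)) zRm)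
        where
          hasRank : Fm 1
          hasRank = ∃ᶠ rankᶠ (` R) #1 #0
          rank-of : ∀ m → (∀ z → R ∋ z ↦ m → ∃[ v ] Rank R z v) → ∃[ v ] Rank R m v
          rank-of m ranks = let (v , ∈v) = image (#0 ↦ᶠ ` m ∈ ` R ∧ᶠ rankᶠ (` R) #0 #1) a
                                  (λ z _ w w′ (_ , r) (_ , r′) → rank-unique r r′)
                            in v , rank-sup m ranks v ∈v

    rank-reflects : ∀ {x y v w} → x ∈ a → y ∈ a → Rank R x v → Rank R y w → v ∈ w → R ∋ x ↦ y
    rank-reflects x∈a y∈a rx ry v∈w with connected x∈a y∈a
    ... | inj₁ xRy = xRy
    ... | inj₂ (inj₁ refl) = ⊥-elim (∈-irrefl (subst (_∈ _) (rank-unique rx ry) v∈w))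
    ... | inj₂ (inj₂ yRx) = ⊥-elim (∈-asym v∈w (rank-mono yRx ry rx))

    rank-injective : ∀ {x y v} → x ∈ a → y ∈ a → Rank R x v → Rank R y v → x ≡ y
    rank-injective x∈a y∈a rx ry with connected x∈a y∈a
    ... | inj₁ xRy = ⊥-elim (∈-irrefl (rank-mono xRy rx ry))
    ... | inj₂ (inj₁ p) = p
    ... | inj₂ (inj₂ yRx) = ⊥-elim (∈-irrefl (rank-mono yRx ry rx))

-- Canonical enumeration of sets of ordinals

module Alephs {ℓ : Level} (em : ExcludedMiddle ℓ) (M : ZFModel ℓ) where
  open OrderTypes em M public

  Ordinals : V → Set ℓ
  Ordinals Z = ∀ x → x ∈ Z → IsOrdinal x

  abstract
    ∈-restrict : V → V
    ∈-restrict Z = rel (#0 ∈ᶠ #1) Z Z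

    ↦-∈-restrict : ∀ {Z x y} → ∈-restrict Z ∋ x ↦ y ⇔ (x ∈ Z × y ∈ Z × x ∈ y)
    ↦-∈-restrict = ↦-rel

    ∈-restrict-graph : ∀ {n} (t : Tm n) → Definable (graphOf λ xs → ∈-restrict (val t xs))
    ∈-restrict-graph t = extensional-graph (definition
      (∃ᶠ ∃ᶠ #1 ∈ᶠ ↑ ↑ ↑ t ∧ᶠ #0 ∈ᶠ ↑ ↑ ↑ t ∧ᶠ #2 ≡ᶠ ⟨ #1 , #0 ⟩ᵗ ∧ᶠ #1 ∈ᶠ #0)) (λ _ _ → ∈-rel)

  ∈-restrictᵗ : ∀ {n} → Tm n → Tm n
  ∈-restrictᵗ t = tm _ (∈-restrict-graph t)

  -- η is the order type of Z ∩ y.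
  Index : V → V → V → Set ℓ
  Index Z y η = Rank (∈-restrict Z) y η

  indexᶠ : ∀ {n} → Tm n → Tm n → Tm n → Fm n
  indexᶠ Z y η = rankᶠ (∈-restrictᵗ Z) y η

  index-onto : ∀ {Z y η θ} → Index Z y η → θ ∈ η → ∃[ z ] z ∈ Z × z ∈ y × Index Z z θ
  index-onto i θ∈η with rank-onto i θ∈η
  ... | z , p , j = let (z∈Z , _ , z∈y) = to ↦-∈-restrict p in z , z∈Z , z∈y , j

  index-mono : ∀ {Z y z η θ} → z ∈ Z → y ∈ Z → z ∈ y → Index Z z θ → Index Z y η → θ ∈ η
  index-mono z∈Z y∈Z z∈y = rank-mono (from ↦-∈-restrict (z∈Z , y∈Z , z∈y))

  index-pred : ∀ {Z y z η} → z ∈ Z → y ∈ Z → z ∈ y → Index Z y η → ∃[ θ ] θ ∈ η × Index Z z θ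
  index-pred z∈Z y∈Z z∈y i = rank-pred i (from ↦-∈-restrict (z∈Z , y∈Z , z∈y))

  module _ {Z : V} (oZ : Ordinals Z) where

    ∈-restrict-wellOrder : IsWellOrder Z (∈-restrict Z)
    ∈-restrict-wellOrder = record
      { domain     = λ h → let (x∈ , y∈ , _) = to ↦-∈-restrict h in x∈ , y∈
      ; transitive = λ h k → let (x∈ , y∈ , p) = to ↦-∈-restrict h ; (_ , z∈ , q) = to ↦-∈-restrict k in
          from ↦-∈-restrict (x∈ , z∈ , proj₁ (oZ _ z∈) _ q _ p)
      ; connected  = λ x∈ y∈ → case trichotomy (oZ _ x∈) (oZ _ y∈) of λ
          { (inj₁ p) → inj₁ (from ↦-∈-restrict (x∈ , y∈ , p))
          ; (inj₂ (inj₁ p)) → inj₂ (inj₁ p)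
          ; (inj₂ (inj₂ p)) → inj₂ (inj₂ (from ↦-∈-restrict (y∈ , x∈ , p))) }
      ; founded    = λ b _ ne → case foundation b ne of λ (m , m∈ , k) →
          m , m∈ , λ x x∈ h → k x x∈ (proj₂ (proj₂ (to ↦-∈-restrict h)))
      }

    index-exists : ∀ {y} → y ∈ Z → ∃[ η ] Index Z y η
    index-exists = rank-exists ∈-restrict-wellOrder

    index-injective : ∀ {x y η} → x ∈ Z → y ∈ Z → Index Z x η → Index Z y η → x ≡ y
    index-injective = rank-injective ∈-restrict-wellOrder

    index-reflects : ∀ {x y η θ} → x ∈ Z → y ∈ Z → Index Z x η → Index Z y θ → η ∈ θ → x ∈ y
    index-reflects x∈ y∈ i j h =
      proj₂ (proj₂ (to ↦-∈-restrict (rank-reflects ∈-restrict-wellOrder x∈ y∈ i j h)))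

    -- The collapse never moves an ordinal up: each θ ∈ η is the index of a smaller z, where
    -- inductively θ ⊆ z ∈ y.
    index-⊆ : ∀ {y η} → y ∈ Z → Index Z y η → η ⊆ y
    index-⊆ y∈Z i = ordinal-induction (∀ᶠ #0 ∈ᶠ ` Z ⇒ᶠ indexᶠ (` Z) #0 #1 ⇒ᶠ #1 ⊆ᶠ #0)
      (λ η _ ih y y∈Z i θ θ∈η → case index-onto i θ∈η of λ (z , z∈Z , z∈y , j) →
        ⊆-∈-trans (proj₁ j) (oZ y y∈Z) (ih θ θ∈η z z∈Z j) z∈y)
      _ (proj₁ i) _ y∈Z i

    abstract
      initial-segment : ∀ {τ} → IsOrdinal τ → (∀ θ → θ ∈ τ → ∃[ z ] z ∈ Z × Index Z z θ) →
                        ∃[ H ] H ⊆ Z × HasOrderType H τ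
      initial-segment {τ} oτ h = H , (λ z z∈ → proj₁ (to ∈H z∈)) , oτ , rel A τ H ,
        rel-bijection A
          (λ θ θ∈ → case h θ θ∈ of λ (z , z∈ , i) → z , from ∈H (z∈ , θ , θ∈ , i) , i)
          (λ z z∈ → proj₂ (to ∈H z∈))
          (λ θ y z _ y∈ z∈ → index-injective (proj₁ (to ∈H y∈)) (proj₁ (to ∈H z∈)))
          (λ _ _ _ _ _ _ → rank-unique) ,
        (λ α β x y p q → case (to ↦-rel p , to ↦-rel q) of λ ((_ , x∈ , i) , (_ , y∈ , j)) →
          let x∈Z = proj₁ (to ∈H x∈) ; y∈Z = proj₁ (to ∈H y∈) in
          mk⇔ (index-reflects x∈Z y∈Z i j) (λ x∈y → index-mono x∈Z y∈Z x∈y i j))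
        where
          A : Fm 2
          A = indexᶠ (` Z) #1 #0
          abstract
            H : V
            H = sep (∃ᶠ #0 ∈ᶠ ` τ ∧ᶠ indexᶠ (` Z) #1 #0) Z
            ∈H : ∀ {z} → z ∈ H ⇔ (z ∈ Z × (∃[ θ ] θ ∈ τ × Index Z z θ))
            ∈H {z} = ∈-sep _ Z z

    abstract
      -- An index that includes τ has all θ ∈ τ as indices of earlier elements, which form a subset
      -- of type τ. Otherwise every index is below τ. With τ = ω₁ this dichotomy provides the
      -- indices of children uniformly in the node.
      long-or-indexed : ∀ {τ} → IsOrdinal τ → (∃[ H ] H ⊆ Z × HasOrderType H τ) ⊎
                        (∀ y → y ∈ Z → ∃[ η ] η ∈ τ × Index Z y η)
      long-or-indexed {τ} oτ with em {∃[ y ] y ∈ Z × (∃[ η ] Index Z y η × τ ⊆ η)}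
      ... | yes (y , y∈ , η , i , s) = inj₁ (initial-segment oτ λ θ θ∈ →
        case index-onto i (s θ θ∈) of λ (z , z∈ , _ , j) → z , z∈ , j)
      ... | no none = inj₂ λ y y∈ → case index-exists y∈ of λ (η , i) →
        case ⊆-or-∋ oτ (proj₁ i) of λ
          { (inj₁ s) → ⊥-elim (none (y , y∈ , η , i , s)) ; (inj₂ p) → η , p , i }

    abstract
      order-type : ∃[ δ ] IsOrdinal δ × Z ≈ δ × (∀ κ → IsOrdinal κ → Z ⊆ κ → δ ⊆ κ)
      order-type with image (indexᶠ (` Z) #0 #1) Z (λ _ _ _ _ → rank-unique)
      ... | δ , ∈δ = δ
        , ordinal (λ η η∈ θ θ∈η → case to (∈δ η) η∈ of λ (y , _ , i) → case index-onto i θ∈η of λ (z , z∈ , _ , j) →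
                    from (∈δ θ) (z , z∈ , j))
                  (λ η η∈ → case to (∈δ η) η∈ of λ (_ , _ , i) → proj₁ i)
        , (rel A Z δ , rel-bijection A
            (λ y y∈ → case index-exists y∈ of λ (η , i) → η , from (∈δ η) (y , y∈ , i) , i)
            (λ η η∈ → to (∈δ η) η∈) (λ _ _ _ _ _ _ → rank-unique) (λ _ _ _ x∈ y∈ _ → index-injective x∈ y∈))
        , λ κ oκ Z⊆κ η η∈ → case to (∈δ η) η∈ of λ (y , y∈ , i) →
            ⊆-∈-trans (proj₁ i) oκ (index-⊆ y∈ i) (Z⊆κ y y∈)
        where
          A : Fm 2
          A = indexᶠ (` Z) #0 #1

  ordertype⇒≈ : ∀ {H τ} → HasOrderType H τ → H ≈ τ
  ordertype⇒≈ (_ , g , b , _) = ≈-sym (g , b)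

-- Hartogs numbers and the next cardinal

module Hartogs {ℓ : Level} (em : ExcludedMiddle ℓ) (M : ZFModel ℓ) where
  open Alephs em M public

  abstract
    -- An element of X may have many codes, but since κ is well-ordered it has a least one. The set
    -- `Y` of least codes is in bijection with X, and its order type is at most κ.
    ≼⇒≈ordinal : ∀ {X κ} → IsOrdinal κ → X ≼ κ → ∃[ δ ] IsOrdinal δ × δ ⊆ κ × X ≈ δ
    ≼⇒≈ordinal {X} {κ} oκ (r , total , injective) =
      case order-type (λ y y∈ → member-ordinal oκ (proj₁ (to ∈Y y∈))) of λ (δ , oδ , Y≈δ , bound) →
        δ , oδ , bound κ oκ (λ y y∈ → proj₁ (to ∈Y y∈)) , ≈-trans (_ , X≈Y) Y≈δ
      where
        A : Fm 2
        A = #0 ↦ᶠ #1 ∈ ` r ∧ᶠ (∀ᶠ #0 ∈ᶠ #2 ⇒ᶠ ¬ᶠ #1 ↦ᶠ #0 ∈ ` r)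
        abstract
          Y : V
          Y = sep (∃ᶠ #0 ∈ᶠ ` X ∧ᶠ #0 ↦ᶠ #1 ∈ ` r ∧ᶠ (∀ᶠ #0 ∈ᶠ #2 ⇒ᶠ ¬ᶠ #1 ↦ᶠ #0 ∈ ` r)) κ
          ∈Y : ∀ {y} → y ∈ Y ⇔ (y ∈ κ × (∃[ x ] x ∈ X × r ∋ x ↦ y × (∀ z → z ∈ y → ¬ r ∋ x ↦ z)))
          ∈Y {y} = ∈-sep _ κ y
        X≈Y : IsBijection X Y (rel A X Y)
        X≈Y = rel-bijection A
          (λ x x∈ → case minimal (` x ↦ᶠ #0 ∈ ` r) κ (total x x∈) of λ (y , y∈ , h , least) →
            let h′ = λ z z∈y → least z (proj₁ oκ y y∈ z z∈y) z∈y in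
            y , from ∈Y (y∈ , x , x∈ , h , h′) , h , h′)
          (λ y y∈ → proj₂ (to ∈Y y∈))
          (λ { x y y′ _ y∈ y′∈ (h , k) (h′ , k′) →
            case trichotomy (member-ordinal oκ (proj₁ (to ∈Y y∈))) (member-ordinal oκ (proj₁ (to ∈Y y′∈))) of λ
              { (inj₁ p) → ⊥-elim (k′ y p h) ; (inj₂ (inj₁ e)) → e ; (inj₂ (inj₂ p)) → ⊥-elim (k y′ p h′) } })
          (λ x x′ y x∈ x′∈ _ (h , _) (h′ , _) → injective x x′ y x∈ x′∈ h h′)

  -- Take the least κ ≤ α with X ≼ κ. The ordinal δ ⊆ κ in bijection with X cannot be smaller, so δ
  -- = κ, and minimality also makes κ a cardinal.
  cardinality-exists : ∀ {X α} → IsOrdinal α → X ≼ α → ∃[ κ ] HasCardinality X κ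
  cardinality-exists {X} {α} oα h
    with minimal (≼ᶠ (` X) #0) (succ α) (α , ∈-succ-self , h)
  ... | κ , κ∈ , X≼κ , least with member-ordinal (succ-ordinal oα) κ∈
  ... | oκ with ≼⇒≈ordinal oκ X≼κ
  ... | δ , oδ , δ⊆κ , X≈δ with ⊆⇒≤ oδ oκ δ⊆κ
  ... | inj₂ δ∈κ = ⊥-elim (least δ (proj₁ (succ-ordinal oα) κ κ∈ δ δ∈κ) δ∈κ (≈⇒≼ X≈δ))
  ... | inj₁ refl = κ , (oκ , λ β β∈ β≈κ →
    least β (proj₁ (succ-ordinal oα) κ κ∈ β β∈) β∈ (≼-trans X≼κ (≈⇒≽ β≈κ))) , X≈δ

  -- Every ordinal embedded in κ consists of ranks of relations on κ.
  hartogs-bound : ∀ κ → ∃[ U ] ∀ α → IsOrdinal α → α ≼ κ → α ⊆ U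
  hartogs-bound κ with image (∃ᶠ ∃ᶠ #2 ≡ᶠ ⟨ #1 , #0 ⟩ᵗ ∧ᶠ rankᶠ #1 #0 #3) (𝒫 (κ ⊗ κ) ⊗ κ)
    (λ { _ _ y y′ (s , x , refl , h) (s′ , x′ , e , h′) → case ⟨,⟩-injective e of λ
      { (refl , refl) → rank-unique h h′ } })
  ... | U , ∈U = U , λ α oα (r , total , injective) x x∈α → embed oα r total injective x x∈α
    where
      embed : ∀ {α} → IsOrdinal α → ∀ r → (∀ x → x ∈ α → ∃[ y ] y ∈ κ × r ∋ x ↦ y) →
              (∀ x x′ y → x ∈ α → x′ ∈ α → r ∋ x ↦ y → r ∋ x′ ↦ y → x ≡ x′) → α ⊆ U
      embed {α} oα r total injective x x∈α = case total x x∈α of λ (y , y∈κ , h) →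
        from (∈U x) (⟨ s , y ⟩ , from ⟨,⟩∈-⊗ (from ∈-𝒫 s⊆ , y∈κ) , s , y , refl ,
          member-ordinal oα x∈α , b , bis , from ∈b (y∈κ , x∈α , h))
        where
          abstract
            s b : V
            -- `s` transports ∈ from α to the codes in κ, and the converse `b` of `r` is a
            -- bisimulation between `s` and ∈. So x is the rank in `s` of any of its codes.
            s = rel (∃ᶠ ∃ᶠ #1 ∈ᶠ ` α ∧ᶠ #0 ∈ᶠ ` α ∧ᶠ #1 ∈ᶠ #0 ∧ᶠ #1 ↦ᶠ #2 ∈ ` r ∧ᶠ #0 ↦ᶠ #3 ∈ ` r) κ κ
            b = rel (#1 ↦ᶠ #0 ∈ ` r) κ α
            ∈s : ∀ {y y′} → s ∋ y ↦ y′ ⇔ (y ∈ κ × y′ ∈ κ ×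
                 (∃[ x ] ∃[ x′ ] x ∈ α × x′ ∈ α × x ∈ x′ × r ∋ x ↦ y × r ∋ x′ ↦ y′))
            ∈s = ↦-rel
            ∈b : ∀ {y x} → b ∋ y ↦ x ⇔ (y ∈ κ × x ∈ α × r ∋ x ↦ y)
            ∈b = ↦-rel
            s⊆ : s ⊆ κ ⊗ κ
            s⊆ p p∈ = case to ∈-rel p∈ of λ (y , y′ , y∈ , y′∈ , e , _) → from ∈-⊗ (y , y′ , y∈ , y′∈ , e)
          bis : Bisimulation s b
          bis y x yx with to ∈b yx
          ... | y∈ , x∈ , h =
            (λ z zsy → case to ∈s zsy of λ { (z∈ , _ , x₁ , x₂ , x₁∈ , x₂∈ , x₁∈x₂ , h₁ , h₂) →
              case injective x₂ x y x₂∈ x∈ h₂ h of λ { refl → x₁ , x₁∈x₂ , from ∈b (z∈ , x₁∈ , h₁) } }) ,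
            (λ w w∈x → let w∈α = proj₁ oα x x∈ w w∈x in case total w w∈α of λ (z , z∈ , k) →
              z , from ∈s (z∈ , y∈ , w , x , w∈α , x∈ , w∈x , k , h) , from ∈b (z∈ , w∈α , k))

  abstract
    -- The Hartogs number of κ. An ordinal embedded in κ is a subset of the bound, hence an element
    -- of its power set, from which it can be separated.
    ℵ : V → V
    ℵ κ = sep (ordinalᶠ #0 ∧ᶠ ≼ᶠ #0 (` κ)) (𝒫 (proj₁ (hartogs-bound κ)))

    ∈-ℵ : ∀ {κ α} → α ∈ ℵ κ ⇔ (IsOrdinal α × α ≼ κ)
    ∈-ℵ {κ} {α} = mk⇔ (λ h → proj₂ (to (∈-sep _ _ α) h))
      (λ (o , e) → from (∈-sep _ _ α) (from ∈-𝒫 (proj₂ (hartogs-bound κ) α o e) , o , e))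

  ℵ-ordinal : ∀ {κ} → IsOrdinal (ℵ κ)
  ℵ-ordinal = ordinal
    (λ β β∈ α α∈β → let (o , e) = to ∈-ℵ β∈ in
      from ∈-ℵ (member-ordinal o α∈β , ≼-trans (⊆⇒≼ (proj₁ o α α∈β)) e))
    (λ α α∈ → proj₁ (to ∈-ℵ α∈))

  ℵ-⋠ : ∀ {κ} → ¬ ℵ κ ≼ κ
  ℵ-⋠ h = ∈-irrefl (from ∈-ℵ (ℵ-ordinal , h))

  ℵ-next : ∀ {κ} → IsOrdinal κ → IsNextCardinal κ (ℵ κ)
  ℵ-next {κ} oκ = (ℵ-ordinal , λ α α∈ α≈ℵ → ℵ-⋠ (≼-trans (≈⇒≽ α≈ℵ) (proj₂ (to ∈-ℵ α∈)))) , κ∈ℵ , least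
    where
      κ∈ℵ = from ∈-ℵ (oκ , ⊆⇒≼ (λ _ → id))
      least : ∀ ν → IsCardinal ν → κ ∈ ν → ℵ κ ≤ₒ ν
      least ν (oν , card) κ∈ν with trichotomy ℵ-ordinal oν
      ... | inj₁ p = inj₂ p
      ... | inj₂ (inj₁ p) = inj₁ p
      ... | inj₂ (inj₂ ν∈ℵ) with ≼⇒≈ordinal oκ (proj₂ (to ∈-ℵ ν∈ℵ))
      ... | δ , oδ , δ⊆κ , ν≈δ = ⊥-elim (card δ (⊆-∈-trans oδ oν δ⊆κ κ∈ν) (≈-sym ν≈δ))

  ω₁ ω₂ : V
  ω₁ = ℵ ω
  ω₂ = ℵ ω₁

  -- Hilbert's hotel: all codes are shifted by one, which frees ∅ for the new element α.
  succ-≼-ω : ∀ {α} → α ≼ ω → succ α ≼ ω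
  succ-≼-ω {α} (r , total , injective) = rel-≼
    ((#0 ∈ᶠ ` α ∧ᶠ (∃ᶠ #1 ↦ᶠ #0 ∈ ` r ∧ᶠ #2 ≡ᶠ succᵗ #0)) ∨ᶠ #0 ≡ᶠ ` α ∧ᶠ #1 ≡ᶠ ∅ᵗ)
    (λ x x∈ → case to ∈-succ x∈ of λ
      { (inj₁ x∈α) → case total x x∈α of λ (k , k∈ω , h) → succ k , succ∈ω k∈ω , inj₁ (x∈α , k , h , refl)
      ; (inj₂ e) → ∅ , ∅∈ω , inj₂ (e , refl) })
    λ { x x′ _ _ _ _ (inj₁ (x∈ , k , h , refl)) (inj₁ (x′∈ , k′ , h′ , e)) →
          case succ-injective e of λ { refl → injective x x′ k x∈ x′∈ h h′ }
      ; _ _ _ _ _ _ (inj₁ (_ , _ , _ , refl)) (inj₂ (_ , e)) → ⊥-elim (succ≢∅ e)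
      ; _ _ _ _ _ _ (inj₂ (_ , refl)) (inj₁ (_ , _ , _ , e)) → ⊥-elim (succ≢∅ (sym e))
      ; _ _ _ _ _ _ (inj₂ (refl , _)) (inj₂ (refl , _)) → refl }

  succ∈ω₁ : ∀ {α} → α ∈ ω₁ → succ α ∈ ω₁
  succ∈ω₁ h = let (o , e) = to ∈-ℵ h in from ∈-ℵ (succ-ordinal o , succ-≼-ω e)

  ω∈ω₁ : ω ∈ ω₁
  ω∈ω₁ = proj₁ (proj₂ (ℵ-next ω-ordinal))

  ω₁-⋠-ω : ¬ ω₁ ≼ ω
  ω₁-⋠-ω = ℵ-⋠

  ω₂-⋠-ω₁ : ¬ ω₂ ≼ ω₁
  ω₂-⋠-ω₁ = ℵ-⋠

-- The squares of ω and ω₁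

module Squares {ℓ : Level} (em : ExcludedMiddle ℓ) (M : ZFModel ℓ) where
  open Hartogs em M public

  module Lexicographic (κ : V) (oκ : IsOrdinal κ) where

    ordinal-κ : ∀ {α} → α ∈ κ → IsOrdinal α
    ordinal-κ = member-ordinal oκ

    abstract
      -- On the whole square a lexicographic initial segment could contain full columns of length κ.
      -- On the triangle β ≤ α the first coordinate bounds both, so the pairs before ⟨ α , β ⟩ lie
      -- in `succ α ⊗ succ α`.
      L : V
      L = rel (#1 ⊆ᶠ #0) κ κ

      ∈L : ∀ {α β} → ⟨ α , β ⟩ ∈ L ⇔ (α ∈ κ × β ∈ κ × β ⊆ α)
      ∈L = ↦-rel

      L-pair : ∀ {p} → p ∈ L → ∃[ α ] ∃[ β ] p ≡ ⟨ α , β ⟩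
      L-pair h = case to ∈-rel h of λ (α , β , _ , _ , e , _) → α , β , e

      lex : V
      lex = rel (∃ᶠ ∃ᶠ ∃ᶠ ∃ᶠ #4 ≡ᶠ ⟨ #3 , #2 ⟩ᵗ ∧ᶠ #5 ≡ᶠ ⟨ #1 , #0 ⟩ᵗ ∧ᶠ
                   (#3 ∈ᶠ #1 ∨ᶠ #3 ≡ᶠ #1 ∧ᶠ #2 ∈ᶠ #0)) L L

      lex-pairs : ∀ {p q} → lex ∋ p ↦ q → ∃[ α ] ∃[ β ] ∃[ γ ] ∃[ δ ] p ≡ ⟨ α , β ⟩ × q ≡ ⟨ γ , δ ⟩
      lex-pairs h = case to ↦-rel h of λ (_ , _ , α , β , γ , δ , e , e′ , _) → α , β , γ , δ , e , e′

      ∈lex : ∀ {α β γ δ} → lex ∋ ⟨ α , β ⟩ ↦ ⟨ γ , δ ⟩ ⇔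
             (⟨ α , β ⟩ ∈ L × ⟨ γ , δ ⟩ ∈ L × (α ∈ γ ⊎ α ≡ γ × β ∈ δ))
      ∈lex = mk⇔
        (λ h → case to ↦-rel h of λ (p∈ , q∈ , α , β , γ , δ , e , e′ , c) →
          case ⟨,⟩-injective e of λ { (refl , refl) →
          case ⟨,⟩-injective e′ of λ { (refl , refl) → p∈ , q∈ , c } })
        (λ (p∈ , q∈ , c) → from ↦-rel (p∈ , q∈ , _ , _ , _ , _ , refl , refl , c))

    private
      lex-domain : ∀ {p q} → lex ∋ p ↦ q → p ∈ L × q ∈ L
      lex-domain h = case lex-pairs h of λ
        { (_ , _ , _ , _ , refl , refl) → case to ∈lex h of λ (p∈ , q∈ , _) → p∈ , q∈ }

      lex-transitive : ∀ {p q r} → lex ∋ p ↦ q → lex ∋ q ↦ r → lex ∋ p ↦ r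
      lex-transitive h k = case (lex-pairs h , lex-pairs k) of λ
        { ((α , β , γ , δ , refl , refl) , _ , _ , ε , ζ , _ , refl) → case (to ∈lex h , to ∈lex k) of λ
          { ((p∈ , _ , c) , (_ , r∈ , d)) → from ∈lex (p∈ , r∈ , compose (ordinal-κ (proj₁ (to ∈L r∈)))
              (ordinal-κ (proj₁ (proj₂ (to ∈L r∈)))) c d) } }
        where
          compose : ∀ {α β γ δ ε ζ} → IsOrdinal ε → IsOrdinal ζ → (α ∈ γ ⊎ α ≡ γ × β ∈ δ) →
                    (γ ∈ ε ⊎ γ ≡ ε × δ ∈ ζ) → α ∈ ε ⊎ α ≡ ε × β ∈ ζ
          compose oε oζ (inj₁ p) (inj₁ q) = inj₁ (proj₁ oε _ q _ p)
          compose oε oζ (inj₁ p) (inj₂ (refl , _)) = inj₁ p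
          compose oε oζ (inj₂ (refl , _)) (inj₁ q) = inj₁ q
          compose oε oζ (inj₂ (refl , p)) (inj₂ (refl , q)) = inj₂ (refl , proj₁ oζ _ q _ p)

      lex-connected : ∀ {p q} → p ∈ L → q ∈ L → lex ∋ p ↦ q ⊎ p ≡ q ⊎ lex ∋ q ↦ p
      lex-connected p∈ q∈ = case (L-pair p∈ , L-pair q∈) of λ
        { ((α , β , refl) , γ , δ , refl) → case (to ∈L p∈ , to ∈L q∈) of λ
          { ((α∈ , β∈ , _) , γ∈ , δ∈ , _) → compare p∈ q∈
              (trichotomy (ordinal-κ α∈) (ordinal-κ γ∈)) (trichotomy (ordinal-κ β∈) (ordinal-κ δ∈)) } }
        where
          compare : ∀ {α β γ δ} → ⟨ α , β ⟩ ∈ L → ⟨ γ , δ ⟩ ∈ L → α ∈ γ ⊎ α ≡ γ ⊎ γ ∈ α → β ∈ δ ⊎ β ≡ δ ⊎ δ ∈ β →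
                    lex ∋ ⟨ α , β ⟩ ↦ ⟨ γ , δ ⟩ ⊎ ⟨ α , β ⟩ ≡ ⟨ γ , δ ⟩ ⊎ lex ∋ ⟨ γ , δ ⟩ ↦ ⟨ α , β ⟩
          compare p∈ q∈ (inj₁ c) _ = inj₁ (from ∈lex (p∈ , q∈ , inj₁ c))
          compare p∈ q∈ (inj₂ (inj₂ c)) _ = inj₂ (inj₂ (from ∈lex (q∈ , p∈ , inj₁ c)))
          compare p∈ q∈ (inj₂ (inj₁ refl)) (inj₁ d) = inj₁ (from ∈lex (p∈ , q∈ , inj₂ (refl , d)))
          compare p∈ q∈ (inj₂ (inj₁ refl)) (inj₂ (inj₁ refl)) = inj₂ (inj₁ refl)
          compare p∈ q∈ (inj₂ (inj₁ refl)) (inj₂ (inj₂ d)) = inj₂ (inj₂ (from ∈lex (q∈ , p∈ , inj₂ (refl , d))))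

      lex-founded : ∀ b → b ⊆ L → (∃[ x ] x ∈ b) → ∃[ m ] m ∈ b × (∀ x → x ∈ b → ¬ lex ∋ x ↦ m)
      lex-founded b b⊆ (x , x∈) = case L-pair (b⊆ x x∈) of λ { (α , β , refl) →
        case minimal (∃ᶠ ⟨ #1 , #0 ⟩ᵗ ∈ᶠ ` b) κ (α , proj₁ (to ∈L (b⊆ x x∈)) , β , x∈) of λ
          { (α₀ , _ , (β′ , p∈) , leastα) →
            case minimal (⟨ ` α₀ , #0 ⟩ᵗ ∈ᶠ ` b) κ (β′ , proj₁ (proj₂ (to ∈L (b⊆ _ p∈))) , p∈) of λ
              { (β₀ , _ , q∈ , leastβ) → ⟨ α₀ , β₀ ⟩ , q∈ , λ y y∈ h → case L-pair (b⊆ y y∈) of λ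
                { (γ , δ , refl) → case to ∈lex h of λ
                  { (r∈ , _ , inj₁ c) → leastα γ (proj₁ (to ∈L r∈)) c (δ , y∈)
                  ; (r∈ , _ , inj₂ (refl , d)) → leastβ δ (proj₁ (proj₂ (to ∈L r∈))) d y∈ } } } } }

    abstract
      lex-wellOrder : IsWellOrder L lex
      lex-wellOrder = record
        { domain = lex-domain ; transitive = lex-transitive ; connected = lex-connected ; founded = lex-founded }

    -- Each γ ∈ α yields the predecessor ⟨ γ , γ ⟩, whose rank includes γ by induction; hence γ lies
    -- below η.
    rank-⊇ : ∀ {α β η} → ⟨ α , β ⟩ ∈ L → Rank lex ⟨ α , β ⟩ η → α ⊆ η
    rank-⊇ {α} {β} {η} p∈ r =
      ordinal-induction (∀ᶠ ∀ᶠ ⟨ #2 , #1 ⟩ᵗ ∈ᶠ ` L ⇒ᶠ rankᶠ (` lex) ⟨ #2 , #1 ⟩ᵗ #0 ⇒ᶠ #2 ⊆ᶠ #0)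
        step α (ordinal-κ (proj₁ (to ∈L p∈))) β η p∈ r
      where
        step : ∀ α → IsOrdinal α → (∀ γ → γ ∈ α → ∀ β η → ⟨ γ , β ⟩ ∈ L → Rank lex ⟨ γ , β ⟩ η → γ ⊆ η) →
               ∀ β η → ⟨ α , β ⟩ ∈ L → Rank lex ⟨ α , β ⟩ η → α ⊆ η
        step α oα ih β η p∈ r γ γ∈α =
          let α∈κ = proj₁ (to ∈L p∈)
              γ∈κ = proj₁ oκ α α∈κ γ γ∈α
              q∈ = from ∈L (γ∈κ , γ∈κ , λ _ → id)
          in case rank-pred r (from ∈lex (q∈ , p∈ , inj₁ γ∈α)) of λ (θ , θ∈η , r′) →
            ⊆-∈-trans (ordinal-κ γ∈κ) (proj₁ r) (ih γ γ∈α γ θ q∈ r′) θ∈η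

    -- The code of (α , β) is j (j (m , α) , β), where j is the order type in
    -- lex and m is the larger of α and β; the first argument of j is always at
    -- least the second one, because m ≤ j (m , α).
    square-≼ : (∀ {p η} → p ∈ L → Rank lex p η → η ∈ κ) → κ ⊗ κ ≼ κ
    square-≼ closed = rel-≼
      (∃ᶠ ∃ᶠ ∃ᶠ ∃ᶠ #4 ≡ᶠ ⟨ #3 , #2 ⟩ᵗ ∧ᶠ ⟨ #1 , #3 ⟩ᵗ ∈ᶠ ` L ∧ᶠ rankᶠ (` lex) ⟨ #1 , #3 ⟩ᵗ #0 ∧ᶠ
         ⟨ #0 , #2 ⟩ᵗ ∈ᶠ ` L ∧ᶠ rankᶠ (` lex) ⟨ #0 , #2 ⟩ᵗ #5)
      (λ p p∈ → case to ∈-⊗ p∈ of λ { (α , β , α∈ , β∈ , refl) →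
        case ⊆-total (ordinal-κ α∈) (ordinal-κ β∈) of λ
          { (inj₁ α⊆β) → code α∈ β∈ β∈ α⊆β (λ _ → id) ; (inj₂ β⊆α) → code α∈ β∈ α∈ (λ _ → id) β⊆α } })
      λ { _ _ γ _ _ _ (α , β , m , q , refl , p∈ , r , p′∈ , r′) (α₁ , β₁ , m₁ , q₁ , refl , p₁∈ , r₁ , p₁′∈ , r₁′) →
        case ⟨,⟩-injective (rank-injective lex-wellOrder p′∈ p₁′∈ r′ r₁′) of λ { (refl , refl) →
        case ⟨,⟩-injective (rank-injective lex-wellOrder p∈ p₁∈ r r₁) of λ { (refl , refl) → refl } } }
      where
        code : ∀ {α β m} → α ∈ κ → β ∈ κ → m ∈ κ → α ⊆ m → β ⊆ m → ∃[ γ ] γ ∈ κ ×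
               (∃[ α′ ] ∃[ β′ ] ∃[ m ] ∃[ q ] ⟨ α , β ⟩ ≡ ⟨ α′ , β′ ⟩ × ⟨ m , α′ ⟩ ∈ L × Rank lex ⟨ m , α′ ⟩ q ×
                  ⟨ q , β′ ⟩ ∈ L × Rank lex ⟨ q , β′ ⟩ γ)
        code {α} {β} {m} α∈ β∈ m∈ α⊆m β⊆m =
          let p∈ = from ∈L (m∈ , α∈ , α⊆m)
              (q , r) = rank-exists lex-wellOrder p∈
              p′∈ = from ∈L (closed p∈ r , β∈ , λ x x∈β → rank-⊇ p∈ r x (β⊆m x x∈β))
              (γ , r′) = rank-exists lex-wellOrder p′∈
          in γ , closed p′∈ r′ , α , β , m , q , refl , p∈ , r , p′∈ , r′

  -- The ranks in the triangle over ω are finite, by a least counterexample: ⟨ 0 , 0 ⟩ is the first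
  -- pair, and every other pair has an immediate predecessor, namely ⟨ m , k ⟩ for ⟨ m , k + 1 ⟩ and
  -- ⟨ k , k ⟩ for ⟨ k + 1 , 0 ⟩.
  ω-square : ω ⊗ ω ≼ ω
  ω-square = square-≼ λ {p} {η} p∈ r → by-contradiction λ η∉ω →
    case IsWellOrder.founded lex-wellOrder Bad (λ q → proj₁ ∘ to ∈Bad) (p , from ∈Bad (p∈ , η , r , η∉ω)) of
    λ (q , q∈ , least) → case to ∈Bad q∈ of λ (q∈L , θ , r′ , θ∉ω) →
      θ∉ω (next q∈L r′ λ u u<q → by-contradiction λ h →
        least u (from ∈Bad (proj₁ (IsWellOrder.domain lex-wellOrder u<q) , bad u<q h)) u<q)
    where
      open Lexicographic ω ω-ordinal
      Finite : V → Set ℓ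
      Finite u = ∀ θ → Rank lex u θ → θ ∈ ω
      abstract
        Bad : V
        Bad = sep (∃ᶠ rankᶠ (` lex) #1 #0 ∧ᶠ ¬ᶠ #0 ∈ᶠ ` ω) L
        ∈Bad : ∀ {p} → p ∈ Bad ⇔ (p ∈ L × (∃[ η ] Rank lex p η × ¬ η ∈ ω))
        ∈Bad {p} = ∈-sep _ L p
      bad : ∀ {u q} → lex ∋ u ↦ q → ¬ Finite u → ∃[ θ ] Rank lex u θ × ¬ θ ∈ ω
      bad _ h = by-contradiction λ k → h λ θ r → by-contradiction λ θ∉ → k (θ , r , θ∉)
      no-predecessor : ∀ {q η} → Rank lex q η → (∀ u → ¬ lex ∋ u ↦ q) → η ∈ ω
      no-predecessor r none = subst (_∈ ω)
        (ext (λ _ h → ⊥-elim (∉-∅ h)) (λ w w∈ → case rank-onto r w∈ of λ (u , u<q , _) → ⊥-elim (none u u<q))) ∅∈ω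
      immediate : ∀ {q η} u → Rank lex q η → lex ∋ u ↦ q → Finite u →
                  (∀ v → lex ∋ v ↦ q → lex ∋ v ↦ u ⊎ v ≡ u) → η ∈ ω
      immediate {q} {η} u r u<q fin last = case rank-pred r u<q of λ (θ , _ , r′) →
        ⊆-∈-trans (proj₁ r) ω-ordinal (λ w w∈ → case rank-onto r w∈ of λ (v , v<q , r″) → from ∈-succ
          (case last v v<q of λ { (inj₁ v<u) → inj₁ (rank-mono v<u r″ r′) ; (inj₂ refl) → inj₂ (rank-unique r″ r′) }))
          (succ∈ω (fin θ r′))
      next : ∀ {q η} → q ∈ L → Rank lex q η → (∀ u → lex ∋ u ↦ q → Finite u) → η ∈ ω
      next q∈ r fin = case L-pair q∈ of λ { (m , n , refl) → case to ∈L q∈ of λ (m∈ , n∈ , n⊆m) →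
        case (ω-cases n∈ , ω-cases m∈) of λ
          { (inj₂ (k , k∈ , refl) , _) →
              let u∈ = from ∈L (m∈ , k∈ , λ z z∈ → n⊆m z (from ∈-succ (inj₁ z∈)))
                  u<q = from ∈lex (u∈ , q∈ , inj₂ (refl , ∈-succ-self))
              in immediate ⟨ m , k ⟩ r u<q (fin _ u<q) λ v v<q → case lex-pairs v<q of λ
                { (a , b , c , d , refl , e) → case to ∈lex v<q of λ
                  { (v∈ , _ , inj₁ c) → inj₁ (from ∈lex (v∈ , u∈ , inj₁ c))
                  ; (v∈ , _ , inj₂ (refl , c)) → case to ∈-succ c of λ
                    { (inj₁ b∈k) → inj₁ (from ∈lex (v∈ , u∈ , inj₂ (refl , b∈k))) ; (inj₂ refl) → inj₂ refl } } }
          ; (inj₁ refl , inj₂ (k , k∈ , refl)) →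
              let u∈ = from ∈L (k∈ , k∈ , λ _ → id)
                  u<q = from ∈lex (u∈ , q∈ , inj₁ ∈-succ-self)
              in immediate ⟨ k , k ⟩ r u<q (fin _ u<q) λ v v<q → case lex-pairs v<q of λ
                { (a , b , c , d , refl , e) → case to ∈lex v<q of λ
                  { (v∈ , _ , inj₁ c) → case to ∈-succ c of λ
                    { (inj₁ a∈k) → inj₁ (from ∈lex (v∈ , u∈ , inj₁ a∈k))
                    ; (inj₂ refl) → case to ∈L v∈ of λ (_ , b∈ , b⊆k) →
                        case ⊆⇒≤ (ordinal-κ b∈) (ordinal-κ k∈) b⊆k of λ
                        { (inj₁ refl) → inj₂ refl ; (inj₂ b∈k) → inj₁ (from ∈lex (v∈ , u∈ , inj₂ (refl , b∈k))) } }
                  ; (v∈ , _ , inj₂ (_ , c)) → ⊥-elim (∉-∅ c) } }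
          ; (inj₁ refl , inj₁ refl) → no-predecessor r λ v v<q → case lex-pairs v<q of λ
              { (a , b , c , d , refl , e) → case to ∈lex v<q of λ
                { (_ , _ , inj₁ c) → ∉-∅ c ; (_ , _ , inj₂ (_ , c)) → ∉-∅ c } } } }

  -- The segment below ⟨ α , β ⟩ embeds into `succ α ⊗ succ α`, which is countable by `ω-square`. So
  -- each rank is a countable ordinal; mere existence of an enumeration suffices here.
  ω₁-square : ω₁ ⊗ ω₁ ≼ ω₁
  ω₁-square = square-≼ λ p∈ r → case L-pair p∈ of λ { (α , β , refl) → case to ∈L p∈ of λ (α∈ , β∈ , β⊆α) →
    from ∈-ℵ (proj₁ r , ≼-trans (segment r) (≼-trans (⊗-mono (proj₂ (to ∈-ℵ (succ∈ω₁ α∈)))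
      (proj₂ (to ∈-ℵ (succ∈ω₁ α∈)))) ω-square)) }
    where
      open Lexicographic ω₁ ℵ-ordinal
      segment : ∀ {α β η} → Rank lex ⟨ α , β ⟩ η → η ≼ succ α ⊗ succ α
      segment {α} {β} {η} r = rel-≼ (#1 ↦ᶠ ` ⟨ α , β ⟩ ∈ ` lex ∧ᶠ rankᶠ (` lex) #1 #0)
        (λ w w∈ → case rank-onto r w∈ of λ (u , u<p , r′) → u , bounded u<p , u<p , r′)
        (λ _ _ _ _ _ _ (_ , r) (_ , r′) → rank-unique r r′)
        where
          bounded : ∀ {u} → lex ∋ u ↦ ⟨ α , β ⟩ → u ∈ succ α ⊗ succ α
          bounded u<p = case lex-pairs u<p of λ { (a , b , c , d , refl , e) → case to ∈lex u<p of λ (u∈ , p∈ , c) →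
            let a∈ = from ∈-succ (case c of λ { (inj₁ q) → inj₁ q ; (inj₂ (q , _)) → inj₂ q })
                (_ , b∈ω₁ , b⊆a) = to ∈L u∈
                oα = ordinal-κ (proj₁ (to ∈L p∈))
            in from ⟨,⟩∈-⊗ (a∈ , ⊆-∈-trans (ordinal-κ b∈ω₁) (succ-ordinal oα) b⊆a a∈) }

-- Trees with uniformly indexed children, and greedy sets

module Recursion {ℓ : Level} (em : ExcludedMiddle ℓ) (M : ZFModel ℓ) where
  open Squares em M public

  abstract
    ternary : Fm 3 → V → V → V → V
    ternary A a b c = rel (∃ᶠ ∃ᶠ #2 ≡ᶠ ⟨ #1 , #0 ⟩ᵗ ∧ᶠ at₃ A #1 #0 #3) (a ⊗ b) c

    ∈-ternary : ∀ {A a b c x y z} → ternary A a b c ∋ ⟨ x , y ⟩ ↦ z ⇔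
                (x ∈ a × y ∈ b × z ∈ c × sem A (x ∷ y ∷ z ∷ []))
    ∈-ternary = mk⇔
      (λ h → case to ↦-rel h of λ (p∈ , z∈ , x , y , e , s) → case ⟨,⟩-injective e of λ { (refl , refl) →
        case to ⟨,⟩∈-⊗ p∈ of λ (x∈ , y∈) → x∈ , y∈ , z∈ , s })
      (λ (x∈ , y∈ , z∈ , s) → from ↦-rel (from ⟨,⟩∈-⊗ (x∈ , y∈) , z∈ , _ , _ , refl , s))

  -- A tree in which the children of each node are indexed by a set of size at
  -- most ω₁ has at most ω₁ nodes.  H relates codes to nodes: ∅ codes the root,
  -- and succ γ codes a child if γ codes the pair of its parent's code and its
  -- index.
  module Tree {X I x₀ t : V} (I≼ω₁ : I ≼ ω₁) (x₀∈X : x₀ ∈ X)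
              (functional : ∀ {x i y y′} → t ∋ ⟨ x , i ⟩ ↦ y → t ∋ ⟨ x , i ⟩ ↦ y′ → y ≡ y′) where
    private
      coding : ω₁ ⊗ I ≼ ω₁
      coding = ≼-trans (⊗-mono (⊆⇒≼ λ _ → id) I≼ω₁) ω₁-square

      abstract
        r : V
        r = proj₁ coding
        r-total : ∀ {c i} → c ∈ ω₁ → i ∈ I → ∃[ γ ] γ ∈ ω₁ × r ∋ ⟨ c , i ⟩ ↦ γ
        r-total c∈ i∈ = proj₁ (proj₂ coding) _ (from ⟨,⟩∈-⊗ (c∈ , i∈))
        r-injective : ∀ {c i c′ i′ γ} → c ∈ ω₁ → i ∈ I → c′ ∈ ω₁ → i′ ∈ I →
                      r ∋ ⟨ c , i ⟩ ↦ γ → r ∋ ⟨ c′ , i′ ⟩ ↦ γ → c ≡ c′ × i ≡ i′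
        r-injective c∈ i∈ c′∈ i′∈ h h′ = ⟨,⟩-injective
          (proj₂ (proj₂ coding) _ _ _ (from ⟨,⟩∈-⊗ (c∈ , i∈)) (from ⟨,⟩∈-⊗ (c′∈ , i′∈)) h h′)

      Closed : V → Set ℓ
      Closed S = S ∋ ∅ ↦ x₀ × (∀ c x i γ y → S ∋ c ↦ x → i ∈ I → r ∋ ⟨ c , i ⟩ ↦ γ → γ ∈ ω₁ →
                                t ∋ ⟨ x , i ⟩ ↦ y → y ∈ X → S ∋ succ γ ↦ y)

      ∅∈ω₁ : ∅ ∈ ω₁
      ∅∈ω₁ = proj₁ ℵ-ordinal _ ω∈ω₁ _ ∅∈ω

      abstract
        -- The intersection of all closed relations, in place of a recursion along the levels of the
        -- tree.
        H : V
        H = sep (∀ᶠ ∅ᵗ ↦ᶠ ` x₀ ∈ #0 ∧ᶠ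
                    (∀ᶠ ∀ᶠ ∀ᶠ ∀ᶠ ∀ᶠ #4 ↦ᶠ #3 ∈ #5 ⇒ᶠ #2 ∈ᶠ ` I ⇒ᶠ ⟨ #4 , #2 ⟩ᵗ ↦ᶠ #1 ∈ ` r ⇒ᶠ #1 ∈ᶠ ` ω₁ ⇒ᶠ
                       ⟨ #3 , #2 ⟩ᵗ ↦ᶠ #0 ∈ ` t ⇒ᶠ #0 ∈ᶠ ` X ⇒ᶠ succᵗ #1 ↦ᶠ #0 ∈ #5)
                  ⇒ᶠ #1 ∈ᶠ #0) (ω₁ ⊗ X)

        ∈H : ∀ {p} → p ∈ H ⇔ (p ∈ ω₁ ⊗ X × (∀ S → Closed S → p ∈ S))
        ∈H {p} = ∈-sep _ _ p

      H⊆ : ∀ {c x} → H ∋ c ↦ x → c ∈ ω₁ × x ∈ X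
      H⊆ h = to ⟨,⟩∈-⊗ (proj₁ (to ∈H h))

      H-closed : Closed H
      H-closed =
        from ∈H (from ⟨,⟩∈-⊗ (∅∈ω₁ , x₀∈X) , λ S → proj₁) ,
        λ c x i γ y h i∈ rγ γ∈ ty y∈ → from ∈H (from ⟨,⟩∈-⊗ (succ∈ω₁ γ∈ , y∈) ,
          λ S cl → proj₂ cl c x i γ y (proj₂ (to ∈H h) S cl) i∈ rγ γ∈ ty y∈)

      H-induction : (Q : Fm 1) → sem Q (⟨ ∅ , x₀ ⟩ ∷ []) →
        (∀ c x i γ y → H ∋ c ↦ x → sem Q (⟨ c , x ⟩ ∷ []) → i ∈ I → r ∋ ⟨ c , i ⟩ ↦ γ → t ∋ ⟨ x , i ⟩ ↦ y →
           sem Q (⟨ succ γ , y ⟩ ∷ [])) →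
        ∀ p → p ∈ H → sem Q (p ∷ [])
      H-induction Q base step p p∈ = proj₂ (to (∈-sep Q H p) (proj₂ (to ∈H p∈) (sep Q H)
        ( from (∈-sep Q H _) (proj₁ H-closed , base)
        , λ c x i γ y h i∈ rγ γ∈ ty y∈ → case to (∈-sep Q H _) h of λ (h , q) →
            from (∈-sep Q H _) (proj₂ H-closed c x i γ y h i∈ rγ γ∈ ty y∈ , step c x i γ y h q i∈ rγ ty) )))

      H-cases : ∀ p → p ∈ H → p ≡ ⟨ ∅ , x₀ ⟩ ⊎ (∃[ c ] ∃[ x ] ∃[ i ] ∃[ γ ] ∃[ y ]
                H ∋ c ↦ x × i ∈ I × r ∋ ⟨ c , i ⟩ ↦ γ × t ∋ ⟨ x , i ⟩ ↦ y × p ≡ ⟨ succ γ , y ⟩)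
      H-cases = H-induction
        (#0 ≡ᶠ ⟨ ∅ᵗ , ` x₀ ⟩ᵗ ∨ᶠ (∃ᶠ ∃ᶠ ∃ᶠ ∃ᶠ ∃ᶠ #4 ↦ᶠ #3 ∈ ` H ∧ᶠ #2 ∈ᶠ ` I ∧ᶠ ⟨ #4 , #2 ⟩ᵗ ↦ᶠ #1 ∈ ` r ∧ᶠ
           ⟨ #3 , #2 ⟩ᵗ ↦ᶠ #0 ∈ ` t ∧ᶠ #5 ≡ᶠ ⟨ succᵗ #1 , #0 ⟩ᵗ))
        (inj₁ refl)
        (λ c x i γ y h _ i∈ rγ ty → inj₂ (c , x , i , γ , y , h , i∈ , rγ , ty , refl))

      -- By injectivity of `r`, a code `succ γ` determines the code of the parent and the index; the
      -- parent is unique by induction and the child by functionality of `t`. A node may have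
      -- several codes, but no code belongs to two nodes, which is what ≼ requires.
      H-functional : ∀ {c x x′} → H ∋ c ↦ x → H ∋ c ↦ x′ → x ≡ x′
      H-functional {c} {x} {x′} h h′ = H-induction
        (∀ᶠ ∀ᶠ ∀ᶠ #3 ≡ᶠ ⟨ #2 , #1 ⟩ᵗ ⇒ᶠ #2 ↦ᶠ #0 ∈ ` H ⇒ᶠ #1 ≡ᶠ #0) base step _ h c x x′ refl h′
        where
          base : ∀ c x x′ → ⟨ ∅ , x₀ ⟩ ≡ ⟨ c , x ⟩ → H ∋ c ↦ x′ → x ≡ x′
          base c x x′ e h = case ⟨,⟩-injective e of λ { (refl , refl) → case H-cases _ h of λ
            { (inj₁ e) → sym (proj₂ (⟨,⟩-injective e))
            ; (inj₂ (_ , _ , _ , _ , _ , _ , _ , _ , _ , e)) → ⊥-elim (succ≢∅ (sym (proj₁ (⟨,⟩-injective e)))) } }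
          step : ∀ c x i γ y → H ∋ c ↦ x → (∀ c₁ x₁ x′ → ⟨ c , x ⟩ ≡ ⟨ c₁ , x₁ ⟩ → H ∋ c₁ ↦ x′ → x₁ ≡ x′) →
                 i ∈ I → r ∋ ⟨ c , i ⟩ ↦ γ → t ∋ ⟨ x , i ⟩ ↦ y →
                 ∀ d z z′ → ⟨ succ γ , y ⟩ ≡ ⟨ d , z ⟩ → H ∋ d ↦ z′ → z ≡ z′
          step c x i γ y h ih i∈ rγ ty d z z′ e k = case ⟨,⟩-injective e of λ { (refl , refl) → case H-cases _ k of λ
            { (inj₁ e) → ⊥-elim (succ≢∅ (proj₁ (⟨,⟩-injective e)))
            ; (inj₂ (c′ , x′ , i′ , γ′ , y′ , h′ , i′∈ , rγ′ , ty′ , e)) → case ⟨,⟩-injective e of λ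
              { (e , refl) → case succ-injective e of λ { refl →
                case r-injective (proj₁ (H⊆ h)) i∈ (proj₁ (H⊆ h′)) i′∈ rγ rγ′ of λ { (refl , refl) →
                case ih c x x′ refl h′ of λ { refl → functional ty ty′ } } } } } }

    abstract
      nodes : V
      nodes = sep (∃ᶠ #0 ↦ᶠ #1 ∈ ` H) X

      private
        ∈-nodes : ∀ {x} → x ∈ nodes ⇔ (x ∈ X × (∃[ c ] H ∋ c ↦ x))
        ∈-nodes {x} = ∈-sep _ X x

      nodes-≼ : nodes ≼ ω₁
      nodes-≼ = rel-≼ (#1 ↦ᶠ #0 ∈ ` H)
        (λ x x∈ → case to ∈-nodes x∈ of λ (_ , c , h) → c , proj₁ (H⊆ h) , h)
        (λ _ _ _ _ _ _ → H-functional)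

      nodes-⊆ : nodes ⊆ X
      nodes-⊆ x = proj₁ ∘ to ∈-nodes

      root∈nodes : x₀ ∈ nodes
      root∈nodes = from ∈-nodes (x₀∈X , ∅ , proj₁ H-closed)

      child∈nodes : ∀ {x i y} → x ∈ nodes → i ∈ I → y ∈ X → t ∋ ⟨ x , i ⟩ ↦ y → y ∈ nodes
      child∈nodes {x} {i} {y} x∈ i∈ y∈ ty = case to ∈-nodes x∈ of λ (_ , c , h) →
        case r-total (proj₁ (H⊆ h)) i∈ of λ (γ , γ∈ , rγ) →
        from ∈-nodes (y∈ , succ γ , proj₂ H-closed c x i γ y h i∈ rγ γ∈ ty y∈)

  infixl 10 _∩_

  abstract
    _∩_ : V → V → V
    a ∩ b = sep (#0 ∈ᶠ ` b) a

    ∈-∩ : ∀ {a b x} → x ∈ a ∩ b ⇔ (x ∈ a × x ∈ b)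
    ∈-∩ {a} {b} {x} = ∈-sep _ a x

    ∩-graph : ∀ {n} (s t : Tm n) → Definable (graphOf λ xs → val s xs ∩ val t xs)
    ∩-graph s t = extensional-graph (definition (#0 ∈ᶠ ↑ s ∧ᶠ #0 ∈ᶠ ↑ t)) (λ _ _ → ∈-∩)

  infixl 10 _∩ᵗ_

  _∩ᵗ_ : ∀ {n} → Tm n → Tm n → Tm n
  s ∩ᵗ t = tm _ (∩-graph s t)

  ⊆-∩ : ∀ {a b} → a ⊆ b → a ∩ b ≡ a
  ⊆-∩ s = ext (λ z → proj₁ ∘ to ∈-∩) (λ z p → from ∈-∩ (p , s z p))

  -- greedy Q δ runs through δ and puts β into the set if Q admits β after the
  -- elements chosen before.  An initial run up to β is recognised by Run.
  Run : V → V → V → Set ℓ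
  Run Q z β = z ⊆ β × (∀ γ → γ ∈ β → γ ∈ z ⇔ Q ∋ z ∩ γ ↦ γ)

  abstract
    run-definable : ∀ {n} (Q z β : Tm n) → Definable (λ xs → Run (val Q xs) (val z xs) (val β xs))
    run-definable Q z β = definition
      (z ⊆ᶠ β ∧ᶠ (∀ᶠ #0 ∈ᶠ ↑ β ⇒ᶠ (#0 ∈ᶠ ↑ z ⇔ᶠ (↑ z ∩ᵗ #0) ↦ᶠ #0 ∈ ↑ Q)))

  runᶠ : ∀ {n} → Tm n → Tm n → Tm n → Fm n
  runᶠ Q z β = fm _ (run-definable Q z β)

  abstract
    greedy : V → V → V
    greedy Q δ = sep (∃ᶠ runᶠ (` Q) #0 #1 ∧ᶠ #0 ↦ᶠ #1 ∈ ` Q) δ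

    ∈-greedy-run : ∀ {Q δ β} → β ∈ greedy Q δ ⇔ (β ∈ δ × (∃[ z ] Run Q z β × Q ∋ z ↦ β))
    ∈-greedy-run {β = β} = ∈-sep _ _ β

    greedy-graph : ∀ {n} (Q δ : Tm n) → Definable (graphOf λ xs → greedy (val Q xs) (val δ xs))
    greedy-graph Q δ = extensional-graph (definition
      (#0 ∈ᶠ ↑ δ ∧ᶠ (∃ᶠ runᶠ (↑ ↑ Q) #0 #1 ∧ᶠ #0 ↦ᶠ #1 ∈ ↑ ↑ Q))) (λ _ _ → ∈-greedy-run)

  greedyᵗ : ∀ {n} → Tm n → Tm n → Tm n
  greedyᵗ Q δ = tm _ (greedy-graph Q δ)

  -- Whether γ enters a run depends only on the part of the run below γ, so two runs agree by
  -- induction.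
  run-unique : ∀ {Q z z′ β} → IsOrdinal β → Run Q z β → Run Q z′ β → z ≡ z′
  run-unique {Q} {z} {z′} {β} oβ (z⊆ , h) (z′⊆ , h′) =
    ext (λ γ p → to (agree γ (z⊆ γ p)) p) (λ γ p → from (agree γ (z′⊆ γ p)) p)
    where
      step : ∀ γ → IsOrdinal γ → (∀ ε → ε ∈ γ → ε ∈ β → ε ∈ z ⇔ ε ∈ z′) → γ ∈ β → γ ∈ z ⇔ γ ∈ z′
      step γ _ ih γ∈β = mk⇔
        (λ p → from (h′ γ γ∈β) (subst (λ w → Q ∋ w ↦ γ) same (to (h γ γ∈β) p)))
        (λ p → from (h γ γ∈β) (subst (λ w → Q ∋ w ↦ γ) (sym same) (to (h′ γ γ∈β) p)))
        where
          agree-below : ∀ {ε} → ε ∈ γ → ε ∈ z ⇔ ε ∈ z′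
          agree-below ε∈γ = ih _ ε∈γ (proj₁ oβ γ γ∈β _ ε∈γ)
          same : z ∩ γ ≡ z′ ∩ γ
          same = ext (λ ε p → let (a , b) = to ∈-∩ p in from ∈-∩ (to (agree-below b) a , b))
                     (λ ε p → let (a , b) = to ∈-∩ p in from ∈-∩ (from (agree-below b) a , b))
      agree : ∀ γ → γ ∈ β → γ ∈ z ⇔ γ ∈ z′
      agree γ γ∈β = ordinal-induction (#0 ∈ᶠ ` β ⇒ᶠ (#0 ∈ᶠ ` z ⇔ᶠ #0 ∈ᶠ ` z′)) step γ (member-ordinal oβ γ∈β) γ∈β

  module _ {Q δ : V} (oδ : IsOrdinal δ) where
    private
      U : V
      U = greedy Q δ

      decide : ∀ {β} → β ∈ δ → Run Q (U ∩ β) β → β ∈ U ⇔ Q ∋ U ∩ β ↦ β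
      decide {β} β∈δ run = mk⇔
        (λ p → case to ∈-greedy-run p of λ (_ , z , run′ , q) →
          subst (λ z → Q ∋ z ↦ β) (run-unique (member-ordinal oδ β∈δ) run′ run) q)
        (λ q → from ∈-greedy-run (β∈δ , _ , run , q))

      ∩-∩ : ∀ {β γ} → γ ⊆ β → U ∩ β ∩ γ ≡ U ∩ γ
      ∩-∩ s = ext (λ z p → let (a , b) = to ∈-∩ p in from ∈-∩ (proj₁ (to ∈-∩ a) , b))
                  (λ z p → let (a , b) = to ∈-∩ p in from ∈-∩ (from ∈-∩ (a , s z b) , b))

      run-∩ : ∀ β → IsOrdinal β → (∀ γ → γ ∈ β → γ ∈ δ → Run Q (U ∩ γ) γ) → β ∈ δ → Run Q (U ∩ β) β
      run-∩ β oβ ih β∈δ = (λ z p → proj₂ (to ∈-∩ p)) , λ γ γ∈β →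
        let γ∈δ = proj₁ oδ β β∈δ γ γ∈β ; d = decide γ∈δ (ih γ γ∈β γ∈δ) ; e = ∩-∩ (proj₁ oβ γ γ∈β) in
        mk⇔ (λ p → subst (λ w → Q ∋ w ↦ γ) (sym e) (to d (proj₁ (to ∈-∩ p))))
            (λ q → from ∈-∩ (from d (subst (λ w → Q ∋ w ↦ γ) e q) , γ∈β))

    greedy-⊆ : greedy Q δ ⊆ δ
    greedy-⊆ β p = proj₁ (to ∈-greedy-run p)

    -- This is the intended recursion equation. By induction the part of the greedy set below β is
    -- itself a run, and by uniqueness it is the one that decided on β.
    ∈-greedy : ∀ {β} → β ∈ δ → β ∈ greedy Q δ ⇔ Q ∋ greedy Q δ ∩ β ↦ β
    ∈-greedy {β} β∈δ = decide β∈δ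
      (ordinal-induction (#0 ∈ᶠ ` δ ⇒ᶠ runᶠ (` Q) (` U ∩ᵗ #0) #0) run-∩ β (member-ordinal oδ β∈δ) β∈δ)

-- Statements (a) and (c): long fibers

module Fibers {ℓ : Level} (em : ExcludedMiddle ℓ) (M : ZFModel ℓ) where
  open Recursion em M public

  ω₂-ordinals : ∀ {a} → a ⊆ ω₂ → Ordinals a
  ω₂-ordinals s x x∈ = member-ordinal ℵ-ordinal (s x x∈)

  ω₁-cardinality : ∀ {H} → HasOrderType H ω₁ → HasCardinality H ω₁
  ω₁-cardinality h = proj₁ (ℵ-next ω-ordinal) , ordertype⇒≈ h

  module _ (f : V) where
    abstract
      fiber : V → V
      fiber c = sep (#0 ↦ᶠ ` c ∈ ` f) ω₂

      ∈-fiber : ∀ {c x} → x ∈ fiber c ⇔ (x ∈ ω₂ × f ∋ x ↦ c)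
      ∈-fiber {c} {x} = ∈-sep _ ω₂ x

      fiber-graph : ∀ {n} (c : Tm n) → Definable (graphOf λ xs → fiber (val c xs))
      fiber-graph c = extensional-graph (definition (#0 ∈ᶠ ` ω₂ ∧ᶠ #0 ↦ᶠ ↑ c ∈ ` f)) (λ _ _ → ∈-fiber)

    fiberᵗ : ∀ {n} → Tm n → Tm n
    fiberᵗ c = tm _ (fiber-graph c)

    LongFiber : V → Set ℓ
    LongFiber c = ∃[ H ] H ⊆ fiber c × HasOrderType H ω₁

    index-in-fiber : ∀ {c x} → ¬ LongFiber c → x ∈ ω₂ → f ∋ x ↦ c → ∃[ η ] η ∈ ω₁ × Index (fiber c) x η
    index-in-fiber none x∈ h with long-or-indexed (ω₂-ordinals λ _ → proj₁ ∘ to ∈-fiber) ℵ-ordinal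
    ... | inj₁ long  = ⊥-elim (none long)
    ... | inj₂ index = index _ (from ∈-fiber (x∈ , h))

  abstract
    ω₂→[ω₁]¹ : Arrow¹ ω₂ ω₁ ω₁
    ω₂→[ω₁]¹ f isF with em {∃[ c ] c ∈ ω₁ × LongFiber f c}
    ... | yes (c , c∈ , H , H⊆ , type) =
      H , (λ x x∈ → proj₁ (to (∈-fiber f) (H⊆ x x∈))) , ω₁-cardinality type , c , c∈ ,
      λ x x∈ → proj₂ (to (∈-fiber f) (H⊆ x x∈))
    ... | no none = ⊥-elim (ω₂-⋠-ω₁ (≼-trans coded ω₁-square))
      where
        coded : ω₂ ≼ ω₁ ⊗ ω₁
        coded = rel-≼ (∃ᶠ ∃ᶠ #3 ≡ᶠ ⟨ #1 , #0 ⟩ᵗ ∧ᶠ #2 ↦ᶠ #1 ∈ ` f ∧ᶠ indexᶠ (fiberᵗ f #1) #2 #0)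
          (λ ξ ξ∈ → case function-value isF ξ∈ of λ (c , c∈ , h) →
            case index-in-fiber f (λ long → none (c , c∈ , long)) ξ∈ h of λ (η , η∈ , i) →
            ⟨ c , η ⟩ , from ⟨,⟩∈-⊗ (c∈ , η∈) , c , η , refl , h , i)
          λ { ξ ξ′ _ ξ∈ ξ′∈ _ (c , η , refl , h , i) (c′ , η′ , e , h′ , i′) → case ⟨,⟩-injective e of λ
            { (refl , refl) → index-injective (ω₂-ordinals λ _ → proj₁ ∘ to (∈-fiber f))
                (from (∈-fiber f) (ξ∈ , h)) (from (∈-fiber f) (ξ′∈ , h′)) i i′ } }

    -- Otherwise κ is countable, and ω₁ would embed into ω through H ⊆ X.
    ω₁≤cardinality : ∀ {X H κ} → H ⊆ X → HasOrderType H ω₁ → HasCardinality X κ → ω₁ ≤ₒ κ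
    ω₁≤cardinality H⊆ type ((oκ , _) , X≈κ) with trichotomy ℵ-ordinal oκ
    ... | inj₁ p = inj₂ p
    ... | inj₂ (inj₁ p) = inj₁ p
    ... | inj₂ (inj₂ κ∈ω₁) = ⊥-elim (ω₁-⋠-ω (≼-trans (≈⇒≽ (ordertype⇒≈ type))
      (≼-trans (⊆⇒≼ H⊆) (≼-trans (≈⇒≼ X≈κ) (proj₂ (to ∈-ℵ κ∈ω₁))))))

  -- Iterating f leads every ordinal down to 0, so if all fibers are short, ω₂
  -- is a tree with root 0 in which the children of α are its fiber.
  module ShortFibers {f : V} (isF : IsFunction (_∈ ω₂) (_∈ ω₂) f)
                     (regressive : ∀ α β → α ∈ ω₂ → 𝟘 ∈ α → f ∋ α ↦ β → β ∈ α)
                     (short : ∀ c → c ∈ ω₂ → ¬ LongFiber f c) where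
    abstract
      t : V
      t = ternary (#2 ∈ᶠ fiberᵗ f #0 ∧ᶠ indexᶠ (fiberᵗ f #0) #2 #1) ω₂ ω₁ ω₂

      ∈t : ∀ {x η y} → t ∋ ⟨ x , η ⟩ ↦ y ⇔ (x ∈ ω₂ × η ∈ ω₁ × y ∈ ω₂ × y ∈ fiber f x × Index (fiber f x) y η)
      ∈t = ∈-ternary

    t-functional : ∀ {x η y y′} → t ∋ ⟨ x , η ⟩ ↦ y → t ∋ ⟨ x , η ⟩ ↦ y′ → y ≡ y′
    t-functional h h′ = case to ∈t h of λ (_ , _ , _ , y∈ , i) → case to ∈t h′ of λ (_ , _ , _ , y′∈ , i′) →
      index-injective (ω₂-ordinals λ _ → proj₁ ∘ to (∈-fiber f)) y∈ y′∈ i i′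

    ∅∈ω₂ : ∅ ∈ ω₂
    ∅∈ω₂ = from ∈-ℵ (∅-ordinal , ⊆⇒≼ λ _ p → ⊥-elim (∉-∅ p))

    open Tree {X = ω₂} {I = ω₁} {t = t} (⊆⇒≼ λ _ → id) ∅∈ω₂ t-functional

    step : ∀ ξ → IsOrdinal ξ → (∀ x → x ∈ ξ → x ∈ ω₂ → x ∈ nodes) → ξ ∈ ω₂ → ξ ∈ nodes
    step ξ oξ ih ξ∈ = case trichotomy ∅-ordinal oξ of λ
      { (inj₂ (inj₁ refl)) → root∈nodes
      ; (inj₂ (inj₂ p)) → ⊥-elim (∉-∅ p)
      ; (inj₁ ∅∈ξ) → case function-value isF ξ∈ of λ (x , x∈ω₂ , h) →
          case index-in-fiber f (short x x∈ω₂) ξ∈ h of λ (η , η∈ , i) →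
          child∈nodes (ih x (regressive ξ x ξ∈ ∅∈ξ h) x∈ω₂) η∈ ξ∈
            (from ∈t (x∈ω₂ , η∈ , ξ∈ , from (∈-fiber f) (ξ∈ , h) , i)) }

    ω₂⊆nodes : ω₂ ⊆ nodes
    ω₂⊆nodes ξ ξ∈ = ordinal-induction (#0 ∈ᶠ ` ω₂ ⇒ᶠ #0 ∈ᶠ ` nodes) step ξ (member-ordinal ℵ-ordinal ξ∈) ξ∈

    impossible : ⊥
    impossible = ω₂-⋠-ω₁ (≼-trans (⊆⇒≼ ω₂⊆nodes) nodes-≼)

  ω₂-regressive : Regressive ω₂ ω₁
  ω₂-regressive f isF regressive = case em {∃[ α ] α ∈ ω₂ × LongFiber f α} of λ
    { (no none) → ⊥-elim (ShortFibers.impossible isF regressive λ c c∈ long → none (c , c∈ , long))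
    ; (yes (α , α∈ , H , H⊆ , type)) →
        α , α∈ , fiber f α ,
        (λ ξ → mk⇔ (proj₂ ∘ to (∈-fiber f)) (λ h → from (∈-fiber f) (proj₁ (function-dom isF h) , h))) ,
        (case cardinality-exists ℵ-ordinal (⊆⇒≼ (λ _ → proj₁ ∘ to (∈-fiber f))) of λ (κ , card) →
          κ , card , ω₁≤cardinality H⊆ type card) }

-- Greedy conflict-free sets, and order type ω + 1

module Kernels {ℓ : Level} (em : ExcludedMiddle ℓ) (M : ZFModel ℓ) where
  open Fibers em M public

  -- `P` holds of D and β if β is a candidate for D, and `E` of D, γ, β if the candidates γ and β
  -- conflict. For (b) the candidates are the common upper neighbours of D and conflict is
  -- adjacency. For (d) they are the indices of family members that include D, and two members
  -- conflict if they meet outside D.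
  module Kernel (P : Fm 2) (E : Fm 3) where

    private
      admissibleᶠ : ∀ {n} → Tm n → Tm n → Tm n → Fm n
      admissibleᶠ D z β = at₂ P D β ∧ᶠ (∀ᶠ #0 ∈ᶠ ↑ z ⇒ᶠ ¬ᶠ at₃ E (↑ D) #0 (↑ β))

    abstract
      admission : V → V
      admission D = rel (admissibleᶠ (` D) #0 #1) (𝒫 ω₂) ω₂

      ∈-admission : ∀ {D z β} → admission D ∋ z ↦ β ⇔ (z ∈ 𝒫 ω₂ × β ∈ ω₂ ×
        sem P (D ∷ β ∷ []) × (∀ γ → γ ∈ z → ¬ sem E (D ∷ γ ∷ β ∷ [])))
      ∈-admission = ↦-rel

      admission-graph : ∀ {n} (D : Tm n) → Definable (graphOf λ xs → admission (val D xs))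
      admission-graph D = extensional-graph (definition
        (∃ᶠ ∃ᶠ #1 ∈ᶠ ` 𝒫 ω₂ ∧ᶠ #0 ∈ᶠ ` ω₂ ∧ᶠ #2 ≡ᶠ ⟨ #1 , #0 ⟩ᵗ ∧ᶠ admissibleᶠ (↑ ↑ ↑ D) #1 #0)) (λ _ _ → ∈-rel)

      kernel : V → V
      kernel D = greedy (admission D) ω₂

      kernel-graph : ∀ {n} (D : Tm n) → Definable (graphOf λ xs → kernel (val D xs))
      kernel-graph D = graph (greedyᵗ (tm _ (admission-graph D)) (` ω₂))

      kernel-⊆ : ∀ {D} → kernel D ⊆ ω₂
      kernel-⊆ = greedy-⊆ ℵ-ordinal

      ∈-kernel : ∀ {D β} → β ∈ kernel D ⇔ (β ∈ ω₂ × sem P (D ∷ β ∷ []) ×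
                 (∀ γ → γ ∈ kernel D → γ ∈ β → ¬ sem E (D ∷ γ ∷ β ∷ [])))
      ∈-kernel {D} {β} = mk⇔
        (λ β∈ → case to ∈-admission (to (∈-greedy ℵ-ordinal (kernel-⊆ β β∈)) β∈) of λ (_ , β∈ω₂ , p , k) →
          β∈ω₂ , p , λ γ γ∈ γ∈β → k γ (from ∈-∩ (γ∈ , γ∈β)))
        (λ (β∈ω₂ , p , k) → from (∈-greedy ℵ-ordinal β∈ω₂) (from ∈-admission
          ( from ∈-𝒫 (λ γ γ∈ → kernel-⊆ γ (proj₁ (to ∈-∩ γ∈))) , β∈ω₂ , p
          , λ γ γ∈ → case to ∈-∩ γ∈ of λ (γ∈K , γ∈β) → k γ γ∈K γ∈β )))

    kernelᵗ : ∀ {n} → Tm n → Tm n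
    kernelᵗ D = tm _ (kernel-graph D)

    kernel-ordinals : ∀ {D} → Ordinals (kernel D)
    kernel-ordinals = ω₂-ordinals kernel-⊆

    -- The decision on β consults smaller elements only, so a rejected candidate conflicts with a
    -- smaller one. The bound γ ∈ β matters in (b), where the walk towards α sees only ordinals
    -- below α.
    kernel-maximal : ∀ {D β} → β ∈ ω₂ → sem P (D ∷ β ∷ []) → ¬ β ∈ kernel D →
                     ∃[ γ ] γ ∈ kernel D × γ ∈ β × sem E (D ∷ γ ∷ β ∷ [])
    kernel-maximal β∈ p β∉ = by-contradiction λ none →
      β∉ (from ∈-kernel (β∈ , p , λ γ γ∈ γ∈β e → none (γ , γ∈ , γ∈β , e)))

  abstract
    -- As D has no largest element, the index of α in `insert α D` is neither zero nor a successor
    -- `succ k` in ω: above the element with index k there is another one in D. If the index is ω,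
    -- then α is the last point of the set H; if it is larger, the first ω + 1 elements serve.
    succ-ω-type : ∀ {D α} → IsOrdinal α → D ⊆ α → (∃[ x ] x ∈ D) → (∀ x → x ∈ D → ∃[ y ] y ∈ D × x ∈ y) →
                  ∃[ H ] H ⊆ insert α D × HasOrderType H (succ ω)
    succ-ω-type {D} {α} oα D⊆α (u , u∈) unbounded = initial-segment oZ (succ-ordinal ω-ordinal) λ θ θ∈ →
      case index-exists oZ α∈Z of λ (η , i) → case ⊆-or-∋ ω-ordinal (proj₁ i) of λ
        { (inj₂ η∈ω) → ⊥-elim (infinite i η∈ω)
        ; (inj₁ ω⊆η) → case to ∈-succ θ∈ of λ
          { (inj₁ θ∈ω) → below i (ω⊆η θ θ∈ω)
          ; (inj₂ refl) → case ⊆⇒≤ ω-ordinal (proj₁ i) ω⊆η of λ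
            { (inj₁ refl) → α , α∈Z , i ; (inj₂ ω∈η) → below i ω∈η } } }
      where
        Z : V
        Z = insert α D
        oZ : Ordinals Z
        oZ x x∈ = case to ∈-insert x∈ of λ { (inj₁ p) → member-ordinal oα (D⊆α x p) ; (inj₂ refl) → oα }
        α∈Z : α ∈ Z
        α∈Z = from ∈-insert (inj₂ refl)
        D⊆Z : ∀ {x} → x ∈ D → x ∈ Z
        D⊆Z p = from ∈-insert (inj₁ p)
        below : ∀ {η θ} → Index Z α η → θ ∈ η → ∃[ z ] z ∈ Z × Index Z z θ
        below i θ∈η = case index-onto i θ∈η of λ (z , z∈ , _ , j) → z , z∈ , j
        infinite : ∀ {η} → Index Z α η → ¬ η ∈ ω
        infinite i η∈ω = case ω-cases η∈ω of λ
          { (inj₁ refl) → case index-pred (D⊆Z u∈) α∈Z (D⊆α u u∈) i of λ (_ , p , _) → ∉-∅ p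
          ; (inj₂ (k , _ , refl)) → case index-onto i ∈-succ-self of λ (z , z∈ , z∈α , j) →
              case to ∈-insert z∈ of λ
                { (inj₂ refl) → ∈-irrefl z∈α
                ; (inj₁ z∈D) → case unbounded z z∈D of λ (y , y∈ , z∈y) →
                    case index-pred (D⊆Z y∈) α∈Z (D⊆α y y∈) i of λ (θ , θ∈ , j′) →
                    case (index-mono z∈ (D⊆Z y∈) z∈y j j′ , to ∈-succ θ∈) of λ
                      { (k∈θ , inj₁ θ∈k) → ∈-asym k∈θ θ∈k ; (k∈θ , inj₂ refl) → ∈-irrefl k∈θ } } }

-- Statement (b): colourings of pairs

module Pairs {ℓ : Level} (em : ExcludedMiddle ℓ) (M : ZFModel ℓ) where
  open Kernels em M public

  module Colouring {f : V} (isF : IsFunction [ ω₂ ]² (_∈ 𝟚) f) where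

    Edge : V → V → Set ℓ
    Edge x y = f ∋ pair x y ↦ 𝟙

    edgeᶠ : ∀ {n} → Tm n → Tm n → Fm n
    edgeᶠ x y = pairᵗ x y ↦ᶠ ` 𝟙 ∈ ` f

    non-edge : ∀ {x y} → x ∈ ω₂ → y ∈ ω₂ → x ≢ y → ¬ Edge x y → f ∋ pair x y ↦ 𝟘
    non-edge {x} {y} x∈ y∈ x≢y ¬e with function-value isF (x , y , x∈ , y∈ , x≢y , refl)
    ... | v , v∈ , h with to ∈-succ v∈
    ... | inj₂ refl = ⊥-elim (¬e h)
    ... | inj₁ v∈𝟙 with to ∈-succ v∈𝟙
    ... | inj₁ v∈𝟘  = ⊥-elim (∉-∅ v∈𝟘)
    ... | inj₂ refl = h

    homogeneous : ∀ {H c} → Ordinals H → (∀ x y → x ∈ H → y ∈ H → x ∈ y → f ∋ pair x y ↦ c) →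
                  ∀ p → [ H ]² p → f ∋ p ↦ c
    homogeneous oH h _ (x , y , x∈ , y∈ , x≢y , refl) with trichotomy (oH x x∈) (oH y y∈)
    ... | inj₁ p        = h x y x∈ y∈ p
    ... | inj₂ (inj₁ p) = ⊥-elim (x≢y p)
    ... | inj₂ (inj₂ p) = subst (λ q → f ∋ q ↦ _) (pair-comm y x) (h y x y∈ x∈ p)

    open Kernel (∀ᶠ #0 ∈ᶠ #1 ⇒ᶠ #0 ∈ᶠ #2 ∧ᶠ edgeᶠ #0 #2) (edgeᶠ #1 #2)

    Homogeneous₀ Homogeneous₁ : Set ℓ
    Homogeneous₀ = ∃[ H ] H ⊆ ω₂ × HasOrderType H ω₁ × (∀ p → [ H ]² p → f ∋ p ↦ 𝟘)
    Homogeneous₁ = ∃[ H ] H ⊆ ω₂ × HasOrderType H (succ ω) × (∀ p → [ H ]² p → f ∋ p ↦ 𝟙)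

    -- The nodes of the tree are sets D, which one may think of as finite
    -- cliques for colour 1, and the children of D are the D ∪ {β} with β in
    -- the colour-0-homogeneous set kernel D.
    module _ (none₀ : ¬ Homogeneous₀) (none₁ : ¬ Homogeneous₁) where

      index-in-kernel : ∀ {D β} → β ∈ kernel D → ∃[ η ] η ∈ ω₁ × Index (kernel D) β η
      index-in-kernel {D} β∈ = case long-or-indexed kernel-ordinals ℵ-ordinal of λ
        { (inj₂ index) → index _ β∈
        ; (inj₁ (H , H⊆ , type)) → ⊥-elim (none₀ (H , (λ x x∈ → kernel-⊆ x (H⊆ x x∈)) , type ,
            homogeneous (λ x x∈ → kernel-ordinals x (H⊆ x x∈)) λ x y x∈ y∈ x∈y →
              non-edge (kernel-⊆ x (H⊆ x x∈)) (kernel-⊆ y (H⊆ y y∈)) (λ { refl → ∈-irrefl x∈y })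
                (proj₂ (proj₂ (to ∈-kernel (H⊆ y y∈))) x (H⊆ x x∈) x∈y))) }

      abstract
        t : V
        t = ternary (∃ᶠ #0 ∈ᶠ kernelᵗ #1 ∧ᶠ indexᶠ (kernelᵗ #1) #0 #2 ∧ᶠ #3 ≡ᶠ insertᵗ #0 #1) (𝒫 ω₂) ω₁ (𝒫 ω₂)

        ∈t : ∀ {D η y} → t ∋ ⟨ D , η ⟩ ↦ y ⇔ (D ∈ 𝒫 ω₂ × η ∈ ω₁ × y ∈ 𝒫 ω₂ ×
             (∃[ β ] β ∈ kernel D × Index (kernel D) β η × y ≡ insert β D))
        ∈t = ∈-ternary

      t-functional : ∀ {D η y y′} → t ∋ ⟨ D , η ⟩ ↦ y → t ∋ ⟨ D , η ⟩ ↦ y′ → y ≡ y′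
      t-functional h h′ = case to ∈t h of λ { (_ , _ , _ , β , β∈ , i , refl) →
        case to ∈t h′ of λ { (_ , _ , _ , β′ , β′∈ , i′ , refl) →
        case index-injective kernel-ordinals β∈ β′∈ i i′ of λ { refl → refl } } }

      open Tree {X = 𝒫 ω₂} {I = ω₁} {t = t} (⊆⇒≼ λ _ → id) (from ∈-𝒫 λ _ p → ⊥-elim (∉-∅ p)) t-functional

      insert-node : ∀ {D β} → D ∈ nodes → β ∈ kernel D → insert β D ∈ nodes
      insert-node {D} {β} D∈ β∈ = case index-in-kernel β∈ of λ (η , η∈ , i) →
        let D∈𝒫 = nodes-⊆ D D∈
            y∈𝒫 = from ∈-𝒫 λ x x∈ → case to ∈-insert x∈ of λ
              { (inj₁ p) → to ∈-𝒫 D∈𝒫 x p ; (inj₂ refl) → kernel-⊆ β β∈ }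
        in child∈nodes D∈ η∈ y∈𝒫 (from ∈t (D∈𝒫 , η∈ , y∈𝒫 , β , β∈ , i , refl))

      -- The walk towards α is the longest path D₀ ⊂ D₁ ⊂ … of nodes all of
      -- whose elements are joined to α by colour 1.
      module Walk {α : V} (α∈ω₂ : α ∈ ω₂) where
        oα : IsOrdinal α
        oα = member-ordinal ℵ-ordinal α∈ω₂

        abstract
          Q : V
          Q = rel (edgeᶠ #1 (` α) ∧ᶠ #1 ∈ᶠ kernelᵗ #0) (𝒫 ω₂) ω₂

          ∈Q : ∀ {z β} → Q ∋ z ↦ β ⇔ (z ∈ 𝒫 ω₂ × β ∈ ω₂ × Edge β α × β ∈ kernel z)
          ∈Q = ↦-rel

          walk : V
          walk = greedy Q α

          walk-⊆ : walk ⊆ α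
          walk-⊆ = greedy-⊆ oα

          walk-⊆ω₂ : walk ⊆ ω₂
          walk-⊆ω₂ x x∈ = proj₁ ℵ-ordinal α α∈ω₂ x (walk-⊆ x x∈)

          ∈-walk : ∀ {β} → β ∈ α → β ∈ walk ⇔ (Edge β α × β ∈ kernel (walk ∩ β))
          ∈-walk {β} β∈α = mk⇔
            (λ p → proj₂ (proj₂ (to ∈Q (to (∈-greedy oα β∈α) p))))
            (λ (e , k) → from (∈-greedy oα β∈α) (from ∈Q
              (from ∈-𝒫 (λ x x∈ → walk-⊆ω₂ x (proj₁ (to ∈-∩ x∈))) , proj₁ ℵ-ordinal α α∈ω₂ β β∈α , e , k)))

        walk-edge : ∀ {β} → β ∈ walk → Edge β α
        walk-edge β∈ = proj₁ (to (∈-walk (walk-⊆ _ β∈)) β∈)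

        walk-kernel : ∀ {β} → β ∈ walk → β ∈ kernel (walk ∩ β)
        walk-kernel β∈ = proj₂ (to (∈-walk (walk-⊆ _ β∈)) β∈)

        walk-clique : ∀ {x y} → x ∈ walk → y ∈ walk → x ∈ y → Edge x y
        walk-clique {x} x∈ y∈ x∈y =
          proj₂ (proj₁ (proj₂ (to ∈-kernel (walk-kernel y∈))) x (from ∈-∩ (x∈ , x∈y)))

        -- A nonempty D without a maximum gives a set of type ω + 1 inside `insert α D`. The walk is
        -- a clique joined to α, so this set would be homogeneous for colour 1.
        maximum : ∀ {D} → D ⊆ walk → (∃[ x ] x ∈ D) → ∃[ m ] m ∈ D × (∀ x → x ∈ D → x ⊆ m)
        maximum {D} D⊆ ne = by-contradiction λ no-max →
          case succ-ω-type oα (λ x x∈ → walk-⊆ x (D⊆ x x∈)) ne (λ x x∈ → by-contradiction λ no-bigger →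
            no-max (x , x∈ , λ y y∈ → case ⊆-or-∋ (ord y∈) (ord x∈) of λ
              { (inj₁ s) → s ; (inj₂ x∈y) → ⊥-elim (no-bigger (y , y∈ , x∈y)) }))
          of λ (H , H⊆ , type) → none₁ (H , (λ x x∈ → in-ω₂ (H⊆ x x∈)) , type ,
            homogeneous (λ x x∈ → member-ordinal ℵ-ordinal (in-ω₂ (H⊆ x x∈))) λ x y x∈ y∈ x∈y →
              clique (to ∈-insert (H⊆ x x∈)) (to ∈-insert (H⊆ y y∈)) x∈y)
          where
            ord : ∀ {x} → x ∈ D → IsOrdinal x
            ord x∈ = member-ordinal oα (walk-⊆ _ (D⊆ _ x∈))
            in-ω₂ : ∀ {x} → x ∈ insert α D → x ∈ ω₂
            in-ω₂ x∈ = case to ∈-insert x∈ of λ { (inj₁ p) → walk-⊆ω₂ _ (D⊆ _ p) ; (inj₂ refl) → α∈ω₂ }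
            clique : ∀ {x y} → x ∈ D ⊎ x ≡ α → y ∈ D ⊎ y ≡ α → x ∈ y → Edge x y
            clique (inj₁ x∈) (inj₁ y∈) x∈y = walk-clique (D⊆ _ x∈) (D⊆ _ y∈) x∈y
            clique (inj₁ x∈) (inj₂ refl) _ = walk-edge (D⊆ _ x∈)
            clique (inj₂ refl) (inj₁ y∈) α∈y = ⊥-elim (∈-asym α∈y (walk-⊆ _ (D⊆ _ y∈)))
            clique (inj₂ refl) (inj₂ refl) α∈α = ⊥-elim (∈-irrefl α∈α)

        -- With m the maximum of `walk ∩ β`, this set is `insert m (walk ∩ m)`, a child of a node by
        -- induction. Since `maximum` applies to every nonempty section of the walk, limit stages
        -- need no separate treatment and finiteness is never stated.
        walk-∩-node : ∀ β → IsOrdinal β → (∀ γ → γ ∈ β → walk ∩ γ ∈ nodes) → walk ∩ β ∈ nodes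
        walk-∩-node β oβ ih = case em {∃[ x ] x ∈ walk ∩ β} of λ
          { (no empty) → subst (_∈ nodes)
              (ext (λ _ p → ⊥-elim (∉-∅ p)) (λ x x∈ → ⊥-elim (empty (x , x∈)))) root∈nodes
          ; (yes ne) → case maximum (λ _ → proj₁ ∘ to ∈-∩) ne of λ (m , m∈ , max) →
              let (m∈W , m∈β) = to ∈-∩ m∈ in
              subst (_∈ nodes) (ext
                (λ x x∈ → from ∈-∩ (case to ∈-insert x∈ of λ
                  { (inj₁ p) → let (a , b) = to ∈-∩ p in a , proj₁ oβ m m∈β x b ; (inj₂ refl) → m∈W , m∈β }))
                (λ x x∈ → from ∈-insert (let (a , b) = to ∈-∩ x∈ in
                  case ⊆⇒≤ (member-ordinal oβ b) (member-ordinal oβ m∈β) (max x x∈) of λ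
                    { (inj₁ p) → inj₂ p ; (inj₂ p) → inj₁ (from ∈-∩ (a , p)) })))
                (insert-node (ih m m∈β) (walk-kernel m∈W)) }

        walk-node : walk ∈ nodes
        walk-node = subst (_∈ nodes) (⊆-∩ walk-⊆)
          (ordinal-induction ((` walk ∩ᵗ #0) ∈ᶠ ` nodes) walk-∩-node α oα)

        -- If α were rejected, some γ ∈ α in `kernel walk` would be adjacent to α. Being above the
        -- whole walk, γ would satisfy the condition for joining it, and so γ ∈ γ.
        end∈kernel : α ∈ kernel walk
        end∈kernel = by-contradiction λ α∉ →
          case kernel-maximal α∈ω₂ (λ x x∈ → walk-⊆ x x∈ , walk-edge x∈) α∉ of λ (γ , γ∈ , γ∈α , e) →
            let above = λ x x∈ → proj₁ (proj₁ (proj₂ (to ∈-kernel γ∈)) x x∈) in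
            ∈-irrefl (above γ (from (∈-walk γ∈α) (e , subst (λ W → γ ∈ kernel W) (sym (⊆-∩ above)) γ∈)))

      -- The code of α is `insert α walk`, from which α is recovered as the largest element.
      ω₂-≼-nodes : ω₂ ≼ nodes
      ω₂-≼-nodes = rel-≼ (#0 ∈ᶠ #1 ∧ᶠ (∀ᶠ #0 ∈ᶠ #2 ⇒ᶠ #0 ⊆ᶠ #1))
        (λ α α∈ → let open Walk α∈ in insert α walk , insert-node walk-node end∈kernel ,
          from ∈-insert (inj₂ refl) , λ x x∈ → case to ∈-insert x∈ of λ
            { (inj₁ p) → proj₁ oα x (walk-⊆ x p) ; (inj₂ refl) → λ _ → id })
        (λ α α′ D _ _ _ (α∈ , max) (α′∈ , max′) → ext (max′ α α∈) (max α′ α′∈))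

      impossible : ⊥
      impossible = ω₂-⋠-ω₁ (≼-trans ω₂-≼-nodes nodes-≼)

  ω₂→[ω₁,ω+1]² : Arrow² ω₂ ω₁ (succ ω)
  ω₂→[ω₁,ω+1]² f isF = case em {Homogeneous₀} of λ
    { (yes h) → inj₁ h
    ; (no none₀) → case em {Homogeneous₁} of λ
      { (yes h) → inj₂ h ; (no none₁) → ⊥-elim (impossible none₀ none₁) } }
    where open Colouring isF

-- Statement (d): delta-systems

module DeltaSystems {ℓ : Level} (em : ExcludedMiddle ℓ) (M : ZFModel ℓ) where
  open Pairs em M public

  abstract
    remove : V → V → V
    remove d X = sep (¬ᶠ #0 ≡ᶠ ` d) X

    ∈-remove : ∀ {d X x} → x ∈ remove d X ⇔ (x ∈ X × x ≢ d)
    ∈-remove {x = x} = ∈-sep _ _ x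

    -- An element coded by the top value k moves to `k₀`, a code of d. By injectivity no remaining
    -- element had that code.
    remove-≼ : ∀ {d X k} → d ∈ X → X ≼ succ k → remove d X ≼ k
    remove-≼ {d} {X} {k} d∈ (r , total , injective) = case total d d∈ of λ (k₀ , k₀∈ , dk₀) →
      rel-≼ (#0 ↦ᶠ #1 ∈ ` r ∨ᶠ #1 ≡ᶠ ` k₀ ∧ᶠ #0 ↦ᶠ ` k ∈ ` r)
        (λ x x∈ → case to ∈-remove x∈ of λ (x∈X , x≢d) → case total x x∈X of λ (y , y∈ , h) →
          case (to ∈-succ y∈ , to ∈-succ k₀∈) of λ
            { (inj₁ y∈k , _) → y , y∈k , inj₁ h
            ; (inj₂ refl , inj₁ k₀∈k) → k₀ , k₀∈k , inj₂ (refl , h)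
            ; (inj₂ refl , inj₂ refl) → ⊥-elim (x≢d (injective x d k x∈X d∈ h dk₀)) })
        (λ x x′ y x∈ x′∈ _ h h′ → case (to ∈-remove x∈ , to ∈-remove x′∈) of λ
          { ((x∈X , x≢d) , (x′∈X , x′≢d)) → case (h , h′) of λ
            { (inj₁ p , inj₁ q) → injective x x′ y x∈X x′∈X p q
            ; (inj₁ p , inj₂ (refl , _)) → ⊥-elim (x≢d (injective x d k₀ x∈X d∈ p dk₀))
            ; (inj₂ (refl , _) , inj₁ q) → ⊥-elim (x′≢d (injective x′ d k₀ x′∈X d∈ q dk₀))
            ; (inj₂ (refl , p) , inj₂ (_ , q)) → injective x x′ k x∈X x′∈X p q } })

  module Family {𝓐 e : V} (finite : ∀ A → A ∈ 𝓐 → IsFinite A × Ordinals A) (bij : IsBijection 𝓐 ω₂ e) where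

    open Kernel (∃ᶠ #0 ↦ᶠ #2 ∈ ` e ∧ᶠ #1 ⊆ᶠ #0)
                (∃ᶠ ∃ᶠ ∃ᶠ #2 ↦ᶠ #4 ∈ ` e ∧ᶠ #1 ↦ᶠ #5 ∈ ` e ∧ᶠ #0 ∈ᶠ #2 ∧ᶠ #0 ∈ᶠ #1 ∧ᶠ ¬ᶠ #0 ∈ᶠ #3)

    ΔSubsystem : Set ℓ
    ΔSubsystem = ∃[ 𝓑 ] 𝓑 ⊆ 𝓐 × IsΔSystem 𝓑 × HasCardinality 𝓑 ω₁

    -- Members with indices in `kernel D` include D because they are candidates, and two of them
    -- meet only inside D because they do not conflict.
    kernel-Δ : ∀ {D H} → H ⊆ kernel D → HasOrderType H ω₁ → ΔSubsystem
    kernel-Δ {D} {H} H⊆ type =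
      𝓑 , (λ A A∈ → proj₁ (to ∈𝓑 A∈)) ,
      (D , λ A B A∈ B∈ A≢B → case (to ∈𝓑 A∈ , to ∈𝓑 B∈) of λ
        { ((_ , ξ , ξ∈ , p) , (_ , ξ′ , ξ′∈ , q)) →
          case trichotomy (kernel-ordinals ξ (H⊆ ξ ξ∈)) (kernel-ordinals ξ′ (H⊆ ξ′ ξ′∈)) of λ
            { (inj₁ c) → meet (H⊆ ξ ξ∈) (H⊆ ξ′ ξ′∈) c p q
            ; (inj₂ (inj₁ refl)) → ⊥-elim (A≢B (bijection-injective bij p q))
            ; (inj₂ (inj₂ c)) → λ z → case meet (H⊆ ξ′ ξ′∈) (H⊆ ξ ξ∈) c q p z of λ i →
                mk⇔ (λ h → let (b , a) = to i h in a , b) (λ (a , b) → from i (b , a)) } }) ,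
      proj₁ (ℵ-next ω-ordinal) , ≈-trans (_ , rel-bijection {𝓑} {H} (#0 ↦ᶠ #1 ∈ ` e)
          (λ A A∈ → proj₂ (to ∈𝓑 A∈))
          (λ ξ ξ∈ → case bijection-onto bij (kernel-⊆ ξ (H⊆ ξ ξ∈)) of λ (A , A∈ , p) → A , from ∈𝓑 (A∈ , ξ , ξ∈ , p) , p)
          (λ _ _ _ _ _ _ → function-unique (proj₁ bij)) (λ _ _ _ _ _ _ → bijection-injective bij))
        (ordertype⇒≈ type)
      where
        abstract
          𝓑 : V
          𝓑 = sep (∃ᶠ #0 ∈ᶠ ` H ∧ᶠ #1 ↦ᶠ #0 ∈ ` e) 𝓐
          ∈𝓑 : ∀ {A} → A ∈ 𝓑 ⇔ (A ∈ 𝓐 × (∃[ ξ ] ξ ∈ H × e ∋ A ↦ ξ))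
          ∈𝓑 {A} = ∈-sep _ 𝓐 A
        D⊆ : ∀ {A ξ} → ξ ∈ kernel D → e ∋ A ↦ ξ → D ⊆ A
        D⊆ ξ∈ p = case to ∈-kernel ξ∈ of λ (_ , (A′ , p′ , s) , _) →
          subst (D ⊆_) (bijection-injective bij p′ p) s
        meet : ∀ {A B ξ ξ′} → ξ ∈ kernel D → ξ′ ∈ kernel D → ξ ∈ ξ′ → e ∋ A ↦ ξ → e ∋ B ↦ ξ′ →
               ∀ z → z ∈ D ⇔ (z ∈ A × z ∈ B)
        meet {A} {B} ξ∈ ξ′∈ c p q z = mk⇔ (λ h → D⊆ ξ∈ p z h , D⊆ ξ′∈ q z h)
          (λ (z∈A , z∈B) → by-contradiction λ z∉D →
            proj₂ (proj₂ (to ∈-kernel ξ′∈)) _ ξ∈ c (A , B , z , p , q , z∈A , z∈B , z∉D))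

    index-in-member : ∀ {A d} → A ∈ 𝓐 → d ∈ A → ∃[ θ ] θ ∈ ω₁ × Index A d θ
    index-in-member A∈ d∈ = case finite _ A∈ of λ { ((n , nat , A≈n) , oA) → case long-or-indexed oA ℵ-ordinal of λ
      { (inj₂ index) → index _ d∈
      ; (inj₁ (H , H⊆ , type)) → ⊥-elim (ω₁-⋠-ω (≼-trans (≈⇒≽ (ordertype⇒≈ type)) (≼-trans (⊆⇒≼ H⊆)
          (≼-trans (≈⇒≼ A≈n) (⊆⇒≼ (proj₁ ω-ordinal n (from ∈-ω nat))))))) } }

    -- The children of a node D are the D ∪ {d} with d in a member of 𝓐 whose
    -- index belongs to kernel D.
    module _ (none : ¬ ΔSubsystem) where

      index-in-kernel : ∀ {D ξ} → ξ ∈ kernel D → ∃[ η ] η ∈ ω₁ × Index (kernel D) ξ η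
      index-in-kernel ξ∈ = case long-or-indexed kernel-ordinals ℵ-ordinal of λ
        { (inj₂ index) → index _ ξ∈ ; (inj₁ (H , H⊆ , type)) → ⊥-elim (none (kernel-Δ H⊆ type)) }

      Child : V → V → V → V → Set ℓ
      Child D η θ y = ∃[ ξ ] ∃[ A ] ∃[ d ] ξ ∈ kernel D × Index (kernel D) ξ η × e ∋ A ↦ ξ ×
                      d ∈ A × Index A d θ × y ≡ insert d D

      abstract
        child-definable : ∀ {n} (D η θ y : Tm n) → Definable (λ xs → Child (val D xs) (val η xs) (val θ xs) (val y xs))
        child-definable D η θ y = definition
          (∃ᶠ ∃ᶠ ∃ᶠ #2 ∈ᶠ kernelᵗ (↑ ↑ ↑ D) ∧ᶠ indexᶠ (kernelᵗ (↑ ↑ ↑ D)) #2 (↑ ↑ ↑ η) ∧ᶠ #1 ↦ᶠ #2 ∈ ` e ∧ᶠ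
             #0 ∈ᶠ #1 ∧ᶠ indexᶠ #1 #0 (↑ ↑ ↑ θ) ∧ᶠ ↑ ↑ ↑ y ≡ᶠ insertᵗ #0 (↑ ↑ ↑ D))

      childᶠ : ∀ {n} → Tm n → Tm n → Tm n → Tm n → Fm n
      childᶠ D η θ y = fm _ (child-definable D η θ y)

      abstract
        t : V
        t = ternary (∃ᶠ ∃ᶠ #3 ≡ᶠ ⟨ #1 , #0 ⟩ᵗ ∧ᶠ childᶠ #2 #1 #0 #4) (𝒫 (⋃ 𝓐)) (ω₁ ⊗ ω₁) (𝒫 (⋃ 𝓐))

        ∈t : ∀ {D i y} → t ∋ ⟨ D , i ⟩ ↦ y ⇔ (D ∈ 𝒫 (⋃ 𝓐) × i ∈ ω₁ ⊗ ω₁ × y ∈ 𝒫 (⋃ 𝓐) ×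
             (∃[ η ] ∃[ θ ] i ≡ ⟨ η , θ ⟩ × Child D η θ y))
        ∈t = ∈-ternary

      child-unique : ∀ {D η θ y y′} → Child D η θ y → Child D η θ y′ → y ≡ y′
      child-unique (ξ , A , d , ξ∈ , i , p , d∈ , j , refl) (ξ′ , A′ , d′ , ξ′∈ , i′ , p′ , d′∈ , j′ , refl) =
        case index-injective kernel-ordinals ξ∈ ξ′∈ i i′ of λ { refl →
        case bijection-injective bij p p′ of λ { refl →
        case index-injective (proj₂ (finite A (proj₁ (function-dom (proj₁ bij) p)))) d∈ d′∈ j j′ of λ { refl → refl } } }

      t-functional : ∀ {D i y y′} → t ∋ ⟨ D , i ⟩ ↦ y → t ∋ ⟨ D , i ⟩ ↦ y′ → y ≡ y′
      t-functional h h′ = case to ∈t h of λ { (_ , _ , _ , η , θ , refl , c) →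
        case to ∈t h′ of λ { (_ , _ , _ , η′ , θ′ , eq , c′) →
        case ⟨,⟩-injective eq of λ { (refl , refl) → child-unique c c′ } } }

      open Tree {X = 𝒫 (⋃ 𝓐)} {I = ω₁ ⊗ ω₁} {t = t} ω₁-square (from ∈-𝒫 λ _ p → ⊥-elim (∉-∅ p)) t-functional

      insert-node : ∀ {D ξ A d} → D ∈ nodes → ξ ∈ kernel D → e ∋ A ↦ ξ → d ∈ A → insert d D ∈ nodes
      insert-node {D} {ξ} {A} {d} D∈ ξ∈ p d∈ =
        let A∈ = proj₁ (function-dom (proj₁ bij) p)
            D∈𝒫 = nodes-⊆ D D∈
            y∈𝒫 = from ∈-𝒫 λ x x∈ → case to ∈-insert x∈ of λ
              { (inj₁ h) → to ∈-𝒫 D∈𝒫 x h ; (inj₂ refl) → from ∈-⋃ (A , A∈ , d∈) }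
        in case index-in-kernel ξ∈ of λ (η , η∈ , i) → case index-in-member A∈ d∈ of λ (θ , θ∈ , j) →
          let i∈ = from ⟨,⟩∈-⊗ (η∈ , θ∈) in
          child∈nodes D∈ i∈ y∈𝒫 (from ∈t (D∈𝒫 , i∈ , y∈𝒫 , η , θ , refl , ξ , A , d , ξ∈ , i , p , d∈ , j , refl))

      -- If the index of A is in `kernel D`, any d in A outside D will do. If it was rejected, A
      -- shares some d outside D with a member B whose index is in `kernel D`, and `insert d D` is a
      -- child of D by way of B.
      enlarge : ∀ {A D} → A ∈ 𝓐 → D ∈ nodes → D ⊆ A → D ≢ A → ∃[ d ] d ∈ A × ¬ d ∈ D × insert d D ∈ nodes
      enlarge {A} {D} A∈ D∈ D⊆A D≢A = case function-value (proj₁ bij) A∈ of λ (ξ , ξ∈ω₂ , p) →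
        case em {ξ ∈ kernel D} of λ
          { (yes ξ∈) → by-contradiction λ h → D≢A (ext D⊆A λ d d∈ → by-contradiction λ d∉ →
              h (d , d∈ , d∉ , insert-node D∈ ξ∈ p d∈))
          ; (no ξ∉) → case kernel-maximal ξ∈ω₂ (A , p , D⊆A) ξ∉ of λ
            { (γ , γ∈ , _ , B , A′ , d , q , p′ , d∈B , d∈A′ , d∉) →
              d , subst (d ∈_) (bijection-injective bij p′ p) d∈A′ , d∉ , insert-node D∈ γ∈ q d∈B } }

      -- X contains the part of A that is not yet exhausted by D.
      member-node : ∀ {A} → A ∈ 𝓐 → A ∈ nodes
      member-node {A} A∈ = case proj₁ (finite A A∈) of λ (n , nat , A≈n) →
        -- Here m bounds the size of the remainder X. The search starts from D = ∅ and X = A with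
        -- bound n; enlarging D by d removes d from X, which contradicts the minimality of m.
        case minimal (∃ᶠ ∃ᶠ #1 ∈ᶠ ` nodes ∧ᶠ #1 ⊆ᶠ ` A ∧ᶠ ≼ᶠ #0 #2 ∧ᶠ (∀ᶠ #0 ∈ᶠ ` A ⇒ᶠ #0 ∈ᶠ #2 ∨ᶠ #0 ∈ᶠ #1)) ω
          (n , from ∈-ω nat , ∅ , A , root∈nodes , (λ _ p → ⊥-elim (∉-∅ p)) , ≈⇒≼ A≈n , λ _ → inj₂) of λ
        { (m , m∈ , (D , X , D∈ , D⊆A , X≼m , cover) , least) → by-contradiction λ A∉ →
          case enlarge A∈ D∈ D⊆A (λ { refl → A∉ D∈ }) of λ (d , d∈A , d∉D , D′∈) →
          let d∈X = case cover d d∈A of λ { (inj₁ h) → ⊥-elim (d∉D h) ; (inj₂ h) → h } in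
          case ω-cases m∈ of λ
            { (inj₁ refl) → case proj₁ (proj₂ X≼m) d d∈X of λ (_ , h , _) → ∉-∅ h
            ; (inj₂ (k , k∈ , refl)) → least k k∈ ∈-succ-self
                ( insert d D , remove d X , D′∈
                , (λ x x∈ → case to ∈-insert x∈ of λ { (inj₁ h) → D⊆A x h ; (inj₂ refl) → d∈A })
                , remove-≼ d∈X X≼m
                , λ x x∈ → case em {x ≡ d} of λ
                    { (yes eq) → inj₁ (from ∈-insert (inj₂ eq))
                    ; (no x≢d) → case cover x x∈ of λ
                      { (inj₁ h) → inj₁ (from ∈-insert (inj₁ h)) ; (inj₂ h) → inj₂ (from ∈-remove (h , x≢d)) } } ) } }

      impossible : ⊥
      impossible = ω₂-⋠-ω₁ (≼-trans (≈⇒≽ (e , bij)) (≼-trans (⊆⇒≼ λ A → member-node) nodes-≼))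

  [ω₂]^<ω→Δ[ω₁] : ArrowΔ ω₂ ω₁
  [ω₂]^<ω→Δ[ω₁] 𝓐 finite (_ , e , bij) = by-contradiction (Family.impossible finite bij)

corollary1p4 : ∀ {ℓ} → ExcludedMiddle ℓ → (M : ZFModel ℓ) → let open SetTheory M in
    ∃[ ω ] ∃[ ω₁ ] ∃[ ω₂ ]
    Is-ω ω × IsNextCardinal ω ω₁ × IsNextCardinal ω₁ ω₂ ×
    Arrow¹ ω₂ ω₁ ω₁ ×
    Arrow² ω₂ ω₁ (succ ω) ×
    Regressive ω₂ ω₁ ×
    ArrowΔ ω₂ ω₁
corollary1p4 em M =
  ω , ω₁ , ω₂ , (λ n → ∈-ω) , ℵ-next ω-ordinal , ℵ-next ℵ-ordinal ,
  ω₂→[ω₁]¹ , ω₂→[ω₁,ω+1]² , ω₂-regressive , [ω₂]^<ω→Δ[ω₁]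
  where open DeltaSystems em M
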